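{- Let $(\ell_n)_{n\in\mathbb{N}}$ be a sequence of positive integers such that for every $n\in\mathbb{N}$ we have $3\le \ell_n\le (\log n)^{1/4}/2$. For each $n$, let $f_n(K_{\ell_n})$ denote the number of labeled graphs on the vertex set $\{1,\dots,n\}$ that do not contain the complete graph $K_{\ell_n}$ as a subgraph. Then $$\log_2 f_n(K_{\ell_n}) = \left(1-\frac{1}{\ell_n-1}\right)\binom{n}{2} + o\!\left(\frac{n^2}{\ell_n}\right)\quad\text{as } n\to\infty.$$
   Context: Here $\log$ denotes the natural logarithm. A graph is $K_\ell$-free if it contains no (not necessarily induced) subgraph isomorphic to the complete graph $K_\ell$ on $\ell$ vertices. The term $o(n^2/\ell_n)$ denotes a quantity $g(n)$ with $g(n)\ell_n/n^2\to 0$ as $n\to\infty$. -}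

module Defs where

open import Data.Bool using (Bool; true; false; _∧_; _∨_; not)
open import Data.Nat using (ℕ; zero; suc; _+_; _*_; _^_; _!; _≡ᵇ_)
open import Data.Product using (_×_; _,_; proj₁; proj₂)
open import Data.List using (List; []; _∷_; _++_; map; concatMap; upTo; zip; length; filterᵇ)
open import Data.Bool.ListAction using (all; any)

-- Vertices of a graph on n vertices are 0,…,n-1 (relabelling {1,…,n}).
-- All unordered pairs {i,j}, written (i , j) with i < j < n.
vertexPairs : ℕ → List (ℕ × ℕ)
vertexPairs n = concatMap (λ j → map (λ i → (i , j)) (upTo j)) (upTo n)

bitstrings : ℕ → List (List Bool)
bitstrings zero = [] ∷ []
bitstrings (suc m) = map (true ∷_) (bitstrings m) ++ map (false ∷_) (bitstrings m)

-- A labeled graph on vertex set {0,…,n-1} is given by its edge indicator: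
-- a bit string indexed by vertexPairs n.  All labeled graphs on n vertices:
labeledGraphs : ℕ → List (List Bool)
labeledGraphs n = bitstrings (length (vertexPairs n))

edgesOf : ℕ → List Bool → List (ℕ × ℕ)
edgesOf n G = map proj₁ (filterᵇ proj₂ (zip (vertexPairs n) G))

adjacent : List (ℕ × ℕ) → ℕ → ℕ → Bool
adjacent E x y = any (λ e → ((proj₁ e ≡ᵇ x) ∧ (proj₂ e ≡ᵇ y)) ∨ ((proj₁ e ≡ᵇ y) ∧ (proj₂ e ≡ᵇ x))) E

membersFrom : ℕ → List Bool → List ℕ
membersFrom i [] = []
membersFrom i (true ∷ bs) = i ∷ membersFrom (suc i) bs
membersFrom i (false ∷ bs) = membersFrom (suc i) bs

orderedPairs : List ℕ → List (ℕ × ℕ)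
orderedPairs [] = []
orderedPairs (x ∷ xs) = map (λ y → (x , y)) xs ++ orderedPairs xs

containsClique : ℕ → ℕ → List Bool → Bool
containsClique ℓ n G =
  any (λ S → (length (membersFrom 0 S) ≡ᵇ ℓ)
             ∧ all (λ p → adjacent (edgesOf n G) (proj₁ p) (proj₂ p)) (orderedPairs (membersFrom 0 S)))
      (bitstrings n)

numCliqueFree : ℕ → ℕ → ℕ
numCliqueFree n ℓ = length (filterᵇ (λ G → not (containsClique ℓ n G)) (labeledGraphs n))

-- expPartial k m = m! · Σ_{j ≤ m} k^j / j!   (an exact natural number).
expPartial : ℕ → ℕ → ℕ
expPartial k zero = 1
expPartial k (suc m) = suc m * expPartial k m + k ^ suc m

-- e^k ≤ n  (for real e^k = Σ_j k^j/j!): every partial sum is ≤ n.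
ExpLe : ℕ → ℕ → Set
ExpLe k n = ∀ m → expPartial k m Data.Nat.≤ n * m !

{-# OPTIONS --safe #-}

-- Lower bound: every subgraph of a balanced complete (ℓ−1)-partite graph is K_ℓ-free.
--
-- Upper bound: a weak-regularity form of the container method.  Every graph G on n vertices is
-- approximated in cut norm by an integer weighting W : V × V → {0,…,M} reached from 0 by at most
-- M² steps, each of which lowers W by 1 on a rectangle A × B or raises it by 1 where W < θ; every
-- step decreases the squared distance Σ (M·G − W)² by n².  Such a W is described by O(M² n) bits.
-- Let D be the pairs with W ≥ θ.  Almost all edges of G lie in D.  Replacing the edges of a clique
-- one at a time by edges of G shows that D has few copies of K_ℓ when G has none, and then
-- deleting vertices of low degree shows that D has at most (1 − 1/(ℓ−1)) n²/2 + o(n²/ℓ) edges.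
-- With M = exp(O(ℓ² log ℓ)) the number of weightings is 2^{o(n²/ℓ)}, since n ≥ exp(16 ℓ⁴).
module Submission where

open import Defs
open import Algebra.Bundles using (CommutativeMonoid)
open import Data.Bool using (Bool; true; false; _∧_; _∨_; not; T; if_then_else_)
open import Data.Bool.Properties using (T?; T-∧; T-∨; ∧-comm; ∧-assoc; ∧-identityʳ; ∧-commutativeMonoid)
open import Data.Fin using (Fin; zero; suc; toℕ)
import Data.Fin as Fin
import Data.Fin.Properties as Fin
open import Data.List using (List; []; _∷_; _++_; _∷ʳ_; _ʳ++_; map; length; lookup; tabulate; concatMap; upTo; zip; filterᵇ; cartesianProductWith)
open import Data.List.Membership.Propositional using (_∈_; find; lose)
open import Data.List.Membership.Propositional.Properties
open import Data.List.Properties using (length-map; length-++; length-tabulate; upTo-∷ʳ)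
open import Data.List.Relation.Unary.All as All using (All; []; _∷_)
import Data.List.Relation.Unary.All.Properties as All
open import Data.List.Relation.Unary.AllPairs as AllPairs using (AllPairs; []; _∷_)
import Data.List.Relation.Unary.AllPairs.Properties as AllPairs
open import Data.List.Relation.Unary.Any using (any?; here; there)
open import Data.List.Relation.Unary.Any.Properties using (any⁺; any⁻)
open import Data.Nat
open import Data.Nat.DivMod
open import Data.Nat.Properties
open import Data.Nat.Tactic.RingSolver using (solve-∀)
open import Data.Product using (Σ; ∃; ∃₂; _×_; _,_; proj₁; proj₂; uncurry)
open import Data.Sum using (_⊎_; inj₁; inj₂; swap)
open import Data.Vec as Vec using (Vec; []; _∷_; _[_]≔_)
open import Data.Vec.Properties using (lookup∘update; lookup∘update′)
open import Function using (_∘_; it; Equivalence)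
open import Relation.Binary.PropositionalEquality
open import Relation.Nullary using (yes; no; contradiction; ¬_; _×-dec_)

open import Algebra.Properties.CommutativeSemigroup +-commutativeSemigroup using () renaming (interchange to +-interchange)
open import Algebra.Properties.CommutativeSemigroup (CommutativeMonoid.commutativeSemigroup ∧-commutativeMonoid) using () renaming (interchange to ∧-interchange; x∙yz≈y∙xz to ∧-x∙yz≈y∙xz)

-- Finite sums

-- Since ℓ grows with n, every loss must be explicit and affordable against log n ≥ 16 ℓ⁴. This
-- forces two scales, `H` and `θ`, with `M = θ * H`. A pair enters D at density θ/M = 1/H, where `H`
-- is polynomial in ℓ and in the inverse of the allowed error: the edges of G on lighter pairs then
-- number at most n²/H and can be listed separately at low cost. Moving one edge of a clique from D
-- to G loses a factor `H` and an additive n^ℓ/θ, so for K_ℓ-free G the exchanges leave at most ℓ²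
-- H^(ℓ²) n^ℓ/θ cliques in D. Taking `θ` to be `H` to the power ℓ² + ℓ + 1 pushes this below what a
-- dense part of D on a fraction of order 1/ℓ of the vertices would force. Approximating in cut
-- norm, instead of by a regular partition, keeps the description cost polynomial in `M` and avoids
-- bounds of tower type.

infixr 8 _▸_

_▸_ : Bool → ℕ → ℕ
true  ▸ v = v
false ▸ v = 0

▸-≤ : ∀ b v → b ▸ v ≤ v
▸-≤ true  v = ≤-refl
▸-≤ false v = z≤n

▸-∧ : ∀ a b v → (a ∧ b) ▸ v ≡ a ▸ b ▸ v
▸-∧ true  b v = refl
▸-∧ false b v = refl

▸-* : ∀ b v → b ▸ v ≡ v * (b ▸ 1)
▸-* true  v = sym (*-identityʳ v)
▸-* false v = sym (*-zeroʳ v)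

∑ : ℕ → (ℕ → ℕ) → ℕ
∑ zero    f = 0
∑ (suc n) f = ∑ n f + f n

∑-cong : ∀ n {f g} → (∀ i → i < n → f i ≡ g i) → ∑ n f ≡ ∑ n g
∑-cong zero    f≡g = refl
∑-cong (suc n) f≡g =
  cong₂ _+_ (∑-cong n λ i i<n → f≡g i (m<n⇒m<1+n i<n)) (f≡g n ≤-refl)

∑-mono : ∀ n {f g} → (∀ i → i < n → f i ≤ g i) → ∑ n f ≤ ∑ n g
∑-mono zero    f≤g = z≤n
∑-mono (suc n) f≤g =
  +-mono-≤ (∑-mono n λ i i<n → f≤g i (m<n⇒m<1+n i<n)) (f≤g n ≤-refl)

∑-const : ∀ n c → ∑ n (λ _ → c) ≡ n * c
∑-const zero    c = refl
∑-const (suc n) c = trans (cong (_+ c) (∑-const n c)) (+-comm (n * c) c)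

∑-+ : ∀ n f g → ∑ n (λ i → f i + g i) ≡ ∑ n f + ∑ n g
∑-+ zero    f g = refl
∑-+ (suc n) f g =
  trans (cong (_+ (f n + g n)) (∑-+ n f g)) (+-interchange (∑ n f) (∑ n g) (f n) (g n))

∑-* : ∀ n c f → ∑ n (λ i → c * f i) ≡ c * ∑ n f
∑-* zero    c f = sym (*-zeroʳ c)
∑-* (suc n) c f =
  trans (cong (_+ c * f n) (∑-* n c f)) (sym (*-distribˡ-+ c (∑ n f) (f n)))

∑-zero : ∀ n → ∑ n (λ _ → 0) ≡ 0
∑-zero n = trans (∑-const n 0) (*-zeroʳ n)

∑-swap : ∀ m n (f : ℕ → ℕ → ℕ) →
  ∑ m (λ i → ∑ n (λ j → f i j)) ≡ ∑ n (λ j → ∑ m (λ i → f i j))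
∑-swap zero    n f = sym (∑-zero n)
∑-swap (suc m) n f =
  trans (cong (_+ ∑ n (f m)) (∑-swap m n f)) (sym (∑-+ n (λ j → ∑ m (λ i → f i j)) (f m)))

∑² : ℕ → (ℕ → ℕ → ℕ) → ℕ
∑² n f = ∑ n λ x → ∑ n λ y → f x y

∑²-cong : ∀ n {f g} → (∀ x y → x < n → y < n → f x y ≡ g x y) → ∑² n f ≡ ∑² n g
∑²-cong n f≡g = ∑-cong n λ x x<n → ∑-cong n λ y y<n → f≡g x y x<n y<n

∑²-mono : ∀ n {f g} → (∀ x y → f x y ≤ g x y) → ∑² n f ≤ ∑² n g
∑²-mono n f≤g = ∑-mono n λ x _ → ∑-mono n λ y _ → f≤g x y

∑²-+ : ∀ n f g → ∑² n (λ x y → f x y + g x y) ≡ ∑² n f + ∑² n g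
∑²-+ n f g = trans (∑-cong n λ x _ → ∑-+ n (f x) (g x)) (∑-+ n _ _)

∑²-* : ∀ n c f → ∑² n (λ x y → c * f x y) ≡ c * ∑² n f
∑²-* n c f = trans (∑-cong n λ x _ → ∑-* n c (f x)) (∑-* n c _)

∑²-const : ∀ n c → ∑² n (λ _ _ → c) ≡ n * n * c
∑²-const n c =
  trans (∑-cong n λ _ _ → ∑-const n c) (trans (∑-const n (n * c)) (sym (*-assoc n n c)))

∑²-swap : ∀ n f → ∑² n f ≡ ∑² n (λ x y → f y x)
∑²-swap n f = ∑-swap n n f

∑ᵛ : ℕ → ∀ s → (Vec ℕ s → ℕ) → ℕ
∑ᵛ n zero    F = F []
∑ᵛ n (suc s) F = ∑ n λ u → ∑ᵛ n s λ x → F (u ∷ x)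

∑ᵛ-cong : ∀ n s {F G} → (∀ x → F x ≡ G x) → ∑ᵛ n s F ≡ ∑ᵛ n s G
∑ᵛ-cong n zero    F≡G = F≡G []
∑ᵛ-cong n (suc s) F≡G = ∑-cong n λ u _ → ∑ᵛ-cong n s λ x → F≡G (u ∷ x)

∑ᵛ-mono : ∀ n s {F G} → (∀ x → F x ≤ G x) → ∑ᵛ n s F ≤ ∑ᵛ n s G
∑ᵛ-mono n zero    F≤G = F≤G []
∑ᵛ-mono n (suc s) F≤G = ∑-mono n λ u _ → ∑ᵛ-mono n s λ x → F≤G (u ∷ x)

∑ᵛ-+ : ∀ n s F G → ∑ᵛ n s (λ x → F x + G x) ≡ ∑ᵛ n s F + ∑ᵛ n s G
∑ᵛ-+ n zero    F G = refl
∑ᵛ-+ n (suc s) F G = trans (∑-cong n λ u _ → ∑ᵛ-+ n s _ _) (∑-+ n _ _)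

∑ᵛ-* : ∀ n s c F → ∑ᵛ n s (λ x → c * F x) ≡ c * ∑ᵛ n s F
∑ᵛ-* n zero    c F = refl
∑ᵛ-* n (suc s) c F = trans (∑-cong n λ u _ → ∑ᵛ-* n s c _) (∑-* n c _)

∑ᵛ-const : ∀ n s c → ∑ᵛ n s (λ _ → c) ≡ n ^ s * c
∑ᵛ-const n zero    c = sym (+-identityʳ c)
∑ᵛ-const n (suc s) c =
  trans (∑-cong n λ _ _ → ∑ᵛ-const n s c)
        (trans (∑-const n (n ^ s * c)) (sym (*-assoc n (n ^ s) c)))

∑-∑ᵛ-swap : ∀ m n s (F : ℕ → Vec ℕ s → ℕ) →
  ∑ m (λ u → ∑ᵛ n s (F u)) ≡ ∑ᵛ n s (λ x → ∑ m λ u → F u x)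
∑-∑ᵛ-swap m n zero    F = refl
∑-∑ᵛ-swap m n (suc s) F =
  trans (∑-swap m n _) (∑-cong n λ v _ → ∑-∑ᵛ-swap m n s λ u x → F u (v ∷ x))

-- The old value of coordinate `a` is overwritten, so summing over it only contributes the factor
-- `n`. This lets a coordinate in the middle of a tuple vary freely without reordering the sum.
∑ᵛ-resample : ∀ n {s} (a : Fin s) F →
  n * ∑ᵛ n s F ≡ ∑ᵛ n s (λ x → ∑ n λ u → F (x [ a ]≔ u))
∑ᵛ-resample n {suc s} zero F =
  trans (sym (∑-const n _)) (∑-cong n λ _ _ → ∑-∑ᵛ-swap n n s λ u x → F (u ∷ x))
∑ᵛ-resample n {suc s} (suc a) F =
  trans (sym (∑-* n n _)) (∑-cong n λ w _ → ∑ᵛ-resample n a λ x → F (w ∷ x))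

-- Clique counts under exchange of relations

Pair : ℕ → Set
Pair s = Fin s × Fin s

Ordered : ∀ {s} → Pair s → Set
Ordered (a , b) = a Fin.< b

sat : ∀ {s} → (ℕ → ℕ → Bool) → List (Pair s) → Vec ℕ s → Bool
sat R []            x = true
sat R ((a , b) ∷ P) x = R (Vec.lookup x a) (Vec.lookup x b) ∧ sat R P x

replace₂ : ∀ {s} → Vec ℕ s → Fin s → Fin s → ℕ → ℕ → Vec ℕ s
replace₂ x a b u v = (x [ a ]≔ u) [ b ]≔ v

module _ {s} {a b : Fin s} (a<b : a Fin.< b) (x : Vec ℕ s) where

  lookup-first : ∀ u v → Vec.lookup (replace₂ x a b u v) a ≡ u
  lookup-first u v =
    trans (lookup∘update′ (Fin.<⇒≢ a<b) (x [ a ]≔ u) v) (lookup∘update a x u)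

  lookup-second : ∀ u v → Vec.lookup (replace₂ x a b u v) b ≡ v
  lookup-second u v = lookup∘update b (x [ a ]≔ u) v

  lookup-other : ∀ {c} → c ≢ a → c ≢ b → ∀ u v →
    Vec.lookup (replace₂ x a b u v) c ≡ Vec.lookup x c
  lookup-other c≢a c≢b u v =
    trans (lookup∘update′ c≢b (x [ a ]≔ u) v) (lookup∘update′ c≢a x u)

module _ {s} (R : ℕ → ℕ → Bool) {a b : Fin s} (a<b : a Fin.< b) (x : Vec ℕ s) where

  -- A pair of positions other than `(a , b)` meets at most one of the two free coordinates, because
  -- the order excludes `(b , a)` and repeated positions. So its constraint depends on `u` alone, on
  -- `v` alone or on neither, which is a rectangle with a full side.
  pair-rectangle : ∀ {c d} → c Fin.< d → (c , d) ≢ (a , b) →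
    ∃₂ λ (A B : ℕ → Bool) → ∀ u v →
      R (Vec.lookup (replace₂ x a b u v) c) (Vec.lookup (replace₂ x a b u v) d) ≡ A u ∧ B v
  pair-rectangle {c} {d} c<d p≢e with c Fin.≟ a | c Fin.≟ b | d Fin.≟ a | d Fin.≟ b
  ... | yes refl | _ | yes refl | _ = contradiction c<d (Fin.<-irrefl refl)
  ... | yes refl | _ | no _ | yes refl = contradiction refl p≢e
  ... | yes refl | _ | no d≢a | no d≢b =
    (λ u → R u (Vec.lookup x d)) , (λ _ → true) , λ u v →
      trans (cong₂ R (lookup-first a<b x u v) (lookup-other a<b x d≢a d≢b u v)) (sym (∧-identityʳ (R u (Vec.lookup x d))))
  ... | no _ | yes refl | yes refl | _ = contradiction a<b (Fin.<-asym c<d)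
  ... | no _ | yes refl | no _ | yes refl = contradiction c<d (Fin.<-irrefl refl)
  ... | no _ | yes refl | no d≢a | no d≢b =
    (λ _ → true) , (λ v → R v (Vec.lookup x d)) , λ u v →
      cong₂ R (lookup-second a<b x u v) (lookup-other a<b x d≢a d≢b u v)
  ... | no c≢a | no c≢b | yes refl | _ =
    (λ u → R (Vec.lookup x c) u) , (λ _ → true) , λ u v →
      trans (cong₂ R (lookup-other a<b x c≢a c≢b u v) (lookup-first a<b x u v)) (sym (∧-identityʳ (R (Vec.lookup x c) u)))
  ... | no c≢a | no c≢b | no _ | yes refl =
    (λ _ → true) , (λ v → R (Vec.lookup x c) v) , λ u v →
      cong₂ R (lookup-other a<b x c≢a c≢b u v) (lookup-second a<b x u v)
  ... | no c≢a | no c≢b | no d≢a | no d≢b =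
    (λ _ → true) , (λ _ → R (Vec.lookup x c) (Vec.lookup x d)) , λ u v →
      cong₂ R (lookup-other a<b x c≢a c≢b u v) (lookup-other a<b x d≢a d≢b u v)

  sat-rectangle : ∀ {P} → All Ordered P → All (_≢ (a , b)) P →
    ∃₂ λ (A B : ℕ → Bool) → ∀ u v → sat R P (replace₂ x a b u v) ≡ A u ∧ B v
  sat-rectangle [] [] = (λ _ → true) , (λ _ → true) , λ _ _ → refl
  sat-rectangle (o ∷ os) (q ∷ qs)
    with A , B , e ← pair-rectangle o q | A′ , B′ , e′ ← sat-rectangle os qs =
    (λ u → A u ∧ A′ u) , (λ v → B v ∧ B′ v) , λ u v →
      trans (cong₂ _∧_ (e u v) (e′ u v)) (∧-interchange (A u) (B v) (A′ u) (B′ v))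

rect : ℕ → (ℕ → Bool) → (ℕ → Bool) → (ℕ → ℕ → ℕ) → ℕ
rect n A B f = ∑² n λ x y → (A x ∧ B y) ▸ f x y

bit▸ : (ℕ → ℕ → Bool) → ℕ → ℕ → ℕ
bit▸ R x y = R x y ▸ 1

-- `d≤g` says that on every rectangle `d` has at most `H` times as many pairs as `g`, up to an
-- additive n²/θ. `N P Q` is the hybrid count: positions in `P` have already been moved to `g`,
-- those in `Q` are still tested in `d`.
module Hybrid (n s θ H : ℕ) .{{_ : NonZero n}} .{{_ : NonZero H}}
  (d g : ℕ → ℕ → Bool)
  (d≤g : ∀ A B → θ * rect n A B (bit▸ d) ≤ θ * H * rect n A B (bit▸ g) + n * n) where

  N : List (Pair s) → List (Pair s) → ℕ
  N P Q = ∑ᵛ n s λ x → (sat g P x ∧ sat d Q x) ▸ 1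

  private
    shuffleᵈ : ∀ a b c d r → ((a ∧ b) ∧ (r ∧ (c ∧ d))) ▸ 1 ≡ ((a ∧ c) ∧ (b ∧ d)) ▸ r ▸ 1
    shuffleᵈ a b c d r = trans
      (cong (_▸ 1) (trans (∧-x∙yz≈y∙xz (a ∧ b) r (c ∧ d))
        (trans (cong (r ∧_) (∧-interchange a b c d)) (∧-comm r _))))
      (▸-∧ ((a ∧ c) ∧ (b ∧ d)) r 1)

    shuffleᵍ : ∀ a b c d r → ((r ∧ (a ∧ b)) ∧ (c ∧ d)) ▸ 1 ≡ ((a ∧ c) ∧ (b ∧ d)) ▸ r ▸ 1
    shuffleᵍ a b c d r = trans
      (cong (_▸ 1) (trans (∧-assoc r (a ∧ b) (c ∧ d))
        (trans (cong (r ∧_) (∧-interchange a b c d)) (∧-comm r _))))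
      (▸-∧ ((a ∧ c) ∧ (b ∧ d)) r 1)

  resample² : ∀ (a b : Fin s) F →
    n * n * ∑ᵛ n s F ≡ ∑ᵛ n s (λ x → ∑² n λ u v → F (replace₂ x a b u v))
  resample² a b F =
    trans (*-assoc n n _) (trans (cong (n *_) (∑ᵛ-resample n b F)) (∑ᵛ-resample n a _))

  -- Once all coordinates but a and b are fixed, the remaining constraints cut out a rectangle.
  exchange : ∀ {a b P Q} → a Fin.< b →
    All Ordered P → All (_≢ (a , b)) P → All Ordered Q → All (_≢ (a , b)) Q →
    θ * N P ((a , b) ∷ Q) ≤ θ * H * N ((a , b) ∷ P) Q + n ^ s
  exchange {a} {b} {P} {Q} a<b oP dP oQ dQ = *-cancelˡ-≤ (n * n) {{m*n≢0 n n}} (begin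
    n * n * (θ * N P (e ∷ Q))                       ≡⟨ x∙yz (n * n) θ _ ⟩
    θ * (n * n * N P (e ∷ Q))                       ≡⟨ cong (θ *_) (resample² a b Fᵈ) ⟩
    θ * ∑ᵛ n s (λ x → ∑² n λ u v → Fᵈ (replace₂ x a b u v))  ≡⟨ ∑ᵛ-* n s θ _ ⟨
    ∑ᵛ n s (λ x → θ * ∑² n λ u v → Fᵈ (replace₂ x a b u v))  ≤⟨ ∑ᵛ-mono n s pointwise ⟩
    ∑ᵛ n s (λ x → θ * H * ∑² n (λ u v → Fᵍ (replace₂ x a b u v)) + n * n)
      ≡⟨ ∑ᵛ-+ n s _ _ ⟩
    ∑ᵛ n s (λ x → θ * H * ∑² n (λ u v → Fᵍ (replace₂ x a b u v))) + ∑ᵛ n s (λ _ → n * n)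
      ≡⟨ cong₂ _+_ (∑ᵛ-* n s (θ * H) _) (∑ᵛ-const n s (n * n)) ⟩
    θ * H * ∑ᵛ n s (λ x → ∑² n (λ u v → Fᵍ (replace₂ x a b u v))) + n ^ s * (n * n)
      ≡⟨ cong (λ z → θ * H * z + n ^ s * (n * n)) (resample² a b Fᵍ) ⟨
    θ * H * (n * n * N (e ∷ P) Q) + n ^ s * (n * n) ≡⟨ collect (θ * H) (n * n) _ (n ^ s) ⟩
    n * n * (θ * H * N (e ∷ P) Q + n ^ s)           ∎)
    where
    open ≤-Reasoning
    e = (a , b)

    Fᵈ Fᵍ : Vec ℕ s → ℕ
    Fᵈ x = (sat g P x ∧ sat d (e ∷ Q) x) ▸ 1
    Fᵍ x = (sat g (e ∷ P) x ∧ sat d Q x) ▸ 1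

    x∙yz : ∀ x y z → x * (y * z) ≡ y * (x * z)
    x∙yz = solve-∀

    collect : ∀ t m k z → t * (m * k) + z * m ≡ m * (t * k + z)
    collect = solve-∀

    pointwise : ∀ x →
      θ * ∑² n (λ u v → Fᵈ (replace₂ x a b u v)) ≤ θ * H * ∑² n (λ u v → Fᵍ (replace₂ x a b u v)) + n * n
    pointwise x
      with A , B , eP ← sat-rectangle g a<b x oP dP | A′ , B′ , eQ ← sat-rectangle d a<b x oQ dQ =
      subst₂ (λ y z → θ * y ≤ θ * H * z + n * n) (∑²-cong n λ u v _ _ → sym (eqᵈ u v))
        (∑²-cong n λ u v _ _ → sym (eqᵍ u v))
        (d≤g (λ u → A u ∧ A′ u) (λ v → B v ∧ B′ v))
      where
      eqᵈ : ∀ u v → Fᵈ (replace₂ x a b u v) ≡ ((A u ∧ A′ u) ∧ (B v ∧ B′ v)) ▸ bit▸ d u v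
      eqᵈ u v = trans
        (cong (_▸ 1) (cong₂ _∧_ (eP u v) (cong₂ _∧_ (cong₂ d (lookup-first a<b x u v) (lookup-second a<b x u v)) (eQ u v))))
        (shuffleᵈ (A u) (B v) (A′ u) (B′ v) (d u v))

      eqᵍ : ∀ u v → Fᵍ (replace₂ x a b u v) ≡ ((A u ∧ A′ u) ∧ (B v ∧ B′ v)) ▸ bit▸ g u v
      eqᵍ u v = trans
        (cong (_▸ 1) (cong₂ _∧_ (cong₂ _∧_ (cong₂ g (lookup-first a<b x u v) (lookup-second a<b x u v)) (eP u v)) (eQ u v)))
        (shuffleᵍ (A u) (B v) (A′ u) (B′ v) (g u v))

  -- Induction on `Q`, moving its head to `P`. The additive loss of a swap is multiplied by `H` once
  -- for each earlier swap; bounding each such factor by `H ^ length Q` gives the error term. The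
  -- moved pairs arrive in reverse order, hence `ʳ++`.
  exchange-all : ∀ Q {P} → All Ordered P → All Ordered Q → AllPairs _≢_ Q →
    All (λ e → All (_≢ e) P) Q →
    θ * N P Q ≤ θ * H ^ length Q * N (Q ʳ++ P) [] + length Q * H ^ length Q * n ^ s
  exchange-all [] {P} _ _ _ _ = begin
    θ * N P []           ≡⟨ cong (_* N P []) (*-identityʳ θ) ⟨
    θ * 1 * N P []       ≡⟨ +-identityʳ _ ⟨
    θ * 1 * N P [] + 0   ∎
    where open ≤-Reasoning
  exchange-all (e ∷ Q) {P} oP (o ∷ oQ) (u ∷ uQ) (f ∷ fQ) = begin
    θ * N P (e ∷ Q)                    ≤⟨ exchange o oP f oQ (All.map ≢-sym u) ⟩
    θ * H * N (e ∷ P) Q + n ^ s        ≡⟨ cong (_+ n ^ s) (tHN θ H _) ⟩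
    H * (θ * N (e ∷ P) Q) + n ^ s
      ≤⟨ +-mono-≤ (*-monoʳ-≤ H (exchange-all Q (o ∷ oP) oQ uQ fresh)) n^s≤ ⟩
    H * (θ * H ^ length Q * N (Q ʳ++ (e ∷ P)) [] + length Q * H ^ length Q * n ^ s)
      + H * H ^ length Q * n ^ s
      ≡⟨ collect H θ (H ^ length Q) _ (length Q) (n ^ s) ⟩
    θ * (H * H ^ length Q) * N (Q ʳ++ (e ∷ P)) [] + suc (length Q) * (H * H ^ length Q) * n ^ s ∎
    where
    open ≤-Reasoning

    fresh : All (λ e′ → All (_≢ e′) (e ∷ P)) Q
    fresh = All.zipWith (λ { (x , y) → x ∷ y }) (u , fQ)

    tHN : ∀ t h k → t * h * k ≡ h * (t * k)
    tHN = solve-∀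

    n^s≤ : n ^ s ≤ H * H ^ length Q * n ^ s
    n^s≤ = m≤n*m (n ^ s) (H * H ^ length Q) {{m*n≢0 H (H ^ length Q) {{it}} {{m^n≢0 H (length Q)}}}}

    collect : ∀ h t p k l z → h * (t * p * k + l * p * z) + h * p * z ≡
      t * (h * p) * k + suc l * (h * p) * z
    collect = solve-∀

-- Supersaturation

allᶠ : ∀ {s} → (Fin s → Bool) → Bool
allᶠ {zero}  p = true
allᶠ {suc s} p = p zero ∧ allᶠ (p ∘ suc)

T-∧⁻ : ∀ {a b} → T (a ∧ b) → T a × T b
T-∧⁻ = Equivalence.to T-∧

allᶠ-T : ∀ {s} {p : Fin s → Bool} → T (allᶠ p) → ∀ i → T (p i)
allᶠ-T t zero    = proj₁ (T-∧⁻ t)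
allᶠ-T {p = p} t (suc i) = allᶠ-T (proj₂ (T-∧⁻ {p zero} t)) i

shift : ∀ {s} → Pair s → Pair (suc s)
shift (a , b) = suc a , suc b

pairs : ∀ s → List (Pair s)
pairs zero    = []
pairs (suc s) = tabulate (λ i → zero , suc i) ++ map shift (pairs s)

sat-tabulate : ∀ R {s m} (f : Fin m → Pair s) x →
  sat R (tabulate f) x ≡ allᶠ (λ i → R (Vec.lookup x (proj₁ (f i))) (Vec.lookup x (proj₂ (f i))))
sat-tabulate R {m = zero}  f x = refl
sat-tabulate R {m = suc m} f x = 
  cong (R (Vec.lookup x (proj₁ (f zero))) (Vec.lookup x (proj₂ (f zero))) ∧_) (sat-tabulate R (f ∘ suc) x)

sat-shift : ∀ R {s} (P : List (Pair s)) y x → sat R (map shift P) (y ∷ x) ≡ sat R P x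
sat-shift R []            y x = refl
sat-shift R ((a , b) ∷ P) y x = cong (R (Vec.lookup x a) (Vec.lookup x b) ∧_) (sat-shift R P y x)

sat-++ : ∀ R {s} (P Q : List (Pair s)) x → sat R (P ++ Q) x ≡ sat R P x ∧ sat R Q x
sat-++ R []            Q x = refl
sat-++ R ((a , b) ∷ P) Q x =
  trans (cong (R (Vec.lookup x a) (Vec.lookup x b) ∧_) (sat-++ R P Q x))
        (sym (∧-assoc (R (Vec.lookup x a) (Vec.lookup x b)) (sat R P x) (sat R Q x)))

sat-pairs : ∀ R {s} y (x : Vec ℕ s) →
  sat R (pairs (suc s)) (y ∷ x) ≡ allᶠ (λ i → R y (Vec.lookup x i)) ∧ sat R (pairs s) x
sat-pairs R {s} y x =
  trans (sat-++ R (tabulate (λ i → zero , suc i)) (map shift (pairs s)) (y ∷ x))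
        (cong₂ _∧_ (sat-tabulate R (λ i → zero , suc i) (y ∷ x)) (sat-shift R (pairs s) y x))

∑-indicator : ∀ n v (f : ℕ → ℕ) → v < n → ∑ n (λ x → (x ≡ᵇ v) ▸ f x) ≡ f v
∑-indicator (suc n) v f v<1+n with v ≟ n
... | yes refl = cong₂ _+_ below (at-n n)
  where
  at-n : ∀ v → (v ≡ᵇ v) ▸ f v ≡ f v
  at-n v with v ≡ᵇ v | ≡⇒≡ᵇ v v refl
  ... | true | _ = refl
  off : ∀ x → x < n → (x ≡ᵇ n) ▸ f x ≡ 0
  off x x<n with x ≡ᵇ n in eq
  ... | false = refl
  ... | true  = contradiction (≡ᵇ⇒≡ x n (subst T (sym eq) _)) (<⇒≢ x<n)
  below : ∑ n (λ x → (x ≡ᵇ n) ▸ f x) ≡ 0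
  below = trans (∑-cong n off) (∑-zero n)
... | no v≢n = trans (cong₂ _+_ (∑-indicator n v f (≤∧≢⇒< (s≤s⁻¹ v<1+n) v≢n)) last) (+-identityʳ (f v))
  where
  last : (n ≡ᵇ v) ▸ f n ≡ 0
  last with n ≡ᵇ v in eq
  ... | false = refl
  ... | true  = contradiction (sym (≡ᵇ⇒≡ n v (subst T (sym eq) _))) v≢n

-- Degrees are measured inside a current vertex set `U`. The critical density is 1 - h′/(r h) = 1 -
-- 1/r + 1/(r h), slightly above the Turán density for K_(r+1); the powers of `h` in the clique
-- count are the price of the slack being only 1/(r h).
module Peel (n r h′ : ℕ) (d : ℕ → ℕ → Bool) (d-sym : ∀ x y → d x y ≡ d y x) .{{_ : NonZero r}} where

  h : ℕ
  h = suc h′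

  card : (ℕ → Bool) → ℕ
  card U = ∑ n λ x → U x ▸ 1

  deg nondeg : (ℕ → Bool) → ℕ → ℕ
  deg    U z = ∑ n λ y → U y ▸ d y z ▸ 1
  nondeg U z = ∑ n λ y → U y ▸ not (d y z) ▸ 1

  edges : (ℕ → Bool) → ℕ
  edges U = rect n U U (bit▸ d)

  deg+nondeg : ∀ U z → deg U z + nondeg U z ≡ card U
  deg+nondeg U z = trans (sym (∑-+ n _ _)) (∑-cong n λ y _ → pt (U y) (d y z))
    where
    pt : ∀ u b → u ▸ b ▸ 1 + u ▸ not b ▸ 1 ≡ u ▸ 1
    pt false b     = refl
    pt true  true  = refl
    pt true  false = refl

  cliques : ℕ → ℕ
  cliques s = ∑ᵛ n s λ x → sat d (pairs s) x ▸ 1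

  module _ (U : ℕ → Bool) (high : ∀ z → T (U z) → r * h * nondeg U z ≤ h′ * card U) where

    common : ∀ {s} → (Fin s → ℕ) → ℕ
    common z = ∑ n λ y → U y ▸ allᶠ (λ i → d y (z i)) ▸ 1

    -- Each of the s vertices excludes at most a fraction h′ / (r h) of U, and s ≤ r leaves 1 / h of it.
    common-bound : ∀ {s} (z : Fin s → ℕ) → (∀ i → T (U (z i))) →
      r * h * card U ≤ r * h * common z + s * (h′ * card U)
    common-bound {zero}  z z∈U = m≤m+n (r * h * card U) 0
    common-bound {suc s} z z∈U = begin
      r * h * card U                                                ≤⟨ common-bound (z ∘ suc) (z∈U ∘ suc) ⟩
      r * h * common (z ∘ suc) + s * (h′ * card U)
        ≤⟨ +-monoˡ-≤ _ (*-monoʳ-≤ (r * h) split) ⟩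
      r * h * (common z + nondeg U (z zero)) + s * (h′ * card U)
        ≡⟨ cong (_+ s * (h′ * card U)) (*-distribˡ-+ (r * h) (common z) _) ⟩
      r * h * common z + r * h * nondeg U (z zero) + s * (h′ * card U)
        ≤⟨ +-monoˡ-≤ _ (+-monoʳ-≤ (r * h * common z) (high (z zero) (z∈U zero))) ⟩
      r * h * common z + h′ * card U + s * (h′ * card U)
        ≡⟨ +-assoc (r * h * common z) _ _ ⟩
      r * h * common z + suc s * (h′ * card U) ∎
      where
      open ≤-Reasoning
      pt : ∀ u a b → u ▸ b ▸ 1 ≤ u ▸ (a ∧ b) ▸ 1 + u ▸ not a ▸ 1
      pt false a     b = z≤n
      pt true  true  b = m≤m+n (b ▸ 1) 0
      pt true  false b = ▸-≤ b 1
      split : common (z ∘ suc) ≤ common z + nondeg U (z zero)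
      split = ≤-trans
        (∑-mono n λ y _ → pt (U y) (d y (z zero)) (allᶠ (λ i → d y (z (suc i)))))
        (≤-reflexive (∑-+ n _ _))

    common-large : ∀ {s} (z : Fin s → ℕ) → (∀ i → T (U (z i))) → s ≤ r → card U ≤ h * common z
    common-large {s} z z∈U s≤r = *-cancelˡ-≤ r (+-cancelʳ-≤ (r * (h′ * card U)) _ _ (begin
      r * card U + r * (h′ * card U)           ≡⟨ e₁ r h′ (card U) ⟩
      r * h * card U                           ≤⟨ common-bound z z∈U ⟩
      r * h * common z + s * (h′ * card U)     ≤⟨ +-monoʳ-≤ (r * h * common z) (*-monoˡ-≤ (h′ * card U) s≤r) ⟩
      r * h * common z + r * (h′ * card U)     ≡⟨ cong (_+ r * (h′ * card U)) (*-assoc r h (common z)) ⟩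
      r * (h * common z) + r * (h′ * card U)   ∎))
      where
      open ≤-Reasoning
      e₁ : ∀ r k u → r * u + r * (k * u) ≡ r * suc k * u
      e₁ = solve-∀

    cliquesIn : ℕ → ℕ
    cliquesIn s = ∑ᵛ n s λ x → (allᶠ (λ i → U (Vec.lookup x i)) ∧ sat d (pairs s) x) ▸ 1

    -- Greedy extension: a clique on at most `r` vertices of `U` has at least `card U / h` common
    -- neighbours in `U`, so each new vertex multiplies the count by at least that much.
    cliquesIn-large : ∀ s → s ≤ suc r → card U ^ s ≤ h ^ s * cliquesIn s
    cliquesIn-large zero    _ = ≤-refl
    cliquesIn-large (suc s) (s≤s s≤r) = begin
      card U * card U ^ s              ≤⟨ *-monoʳ-≤ (card U) (cliquesIn-large s (m≤n⇒m≤1+n s≤r)) ⟩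
      card U * (h ^ s * cliquesIn s)   ≡⟨ e₁ (card U) (h ^ s) (cliquesIn s) ⟩
      h ^ s * (card U * cliquesIn s)   ≤⟨ *-monoʳ-≤ (h ^ s) extend ⟩
      h ^ s * (h * cliquesIn (suc s))  ≡⟨ e₂ (h ^ s) h (cliquesIn (suc s)) ⟩
      h ^ suc s * cliquesIn (suc s)    ∎
      where
      open ≤-Reasoning
      e₁ : ∀ a b c → a * (b * c) ≡ b * (a * c)
      e₁ = solve-∀
      e₂ : ∀ a b c → a * (b * c) ≡ b * a * c
      e₂ = solve-∀
      F : Vec ℕ s → Bool
      F x = allᶠ (λ i → U (Vec.lookup x i)) ∧ sat d (pairs s) x
      pt : ∀ u b c q → (b ∧ q) ▸ u ▸ c ▸ 1 ≡ ((u ∧ b) ∧ (c ∧ q)) ▸ 1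
      pt false true  c true  = refl
      pt false true  c false = refl
      pt false false c q     = refl
      pt true false c q      = refl
      pt true true  true  true  = refl
      pt true true  true  false = refl
      pt true true  false true  = refl
      pt true true  false false = refl
      ▸-∑ : ∀ b f → b ▸ ∑ n f ≡ ∑ n λ y → b ▸ f y
      ▸-∑ true  f = refl
      ▸-∑ false f = sym (∑-zero n)
      regroup : ∑ᵛ n s (λ x → F x ▸ common (Vec.lookup x)) ≡ cliquesIn (suc s)
      regroup = trans (∑ᵛ-cong n s λ x → ▸-∑ (F x) _) (trans (sym (∑-∑ᵛ-swap n n s _))
        (∑-cong n λ y _ → ∑ᵛ-cong n s λ x →
          trans (pt (U y) (allᶠ (λ i → U (Vec.lookup x i))) (allᶠ (λ i → d y (Vec.lookup x i))) (sat d (pairs s) x))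
            (cong (λ q → ((U y ∧ allᶠ (λ i → U (Vec.lookup x i))) ∧ q) ▸ 1) (sym (sat-pairs d y x)))))
      each : ∀ x → card U * (F x ▸ 1) ≤ h * (F x ▸ common (Vec.lookup x))
      each x with F x in eq
      ... | false = ≤-reflexive (trans (*-zeroʳ (card U)) (sym (*-zeroʳ h)))
      ... | true  = ≤-trans (≤-reflexive (*-identityʳ (card U)))
        (common-large (Vec.lookup x) (allᶠ-T (proj₁ (T-∧⁻ {allᶠ (λ i → U (Vec.lookup x i))} (subst T (sym eq) _)))) s≤r)
      extend : card U * cliquesIn s ≤ h * cliquesIn (suc s)
      extend = begin
        card U * cliquesIn s                            ≡⟨ ∑ᵛ-* n s (card U) _ ⟨
        ∑ᵛ n s (λ x → card U * (F x ▸ 1))               ≤⟨ ∑ᵛ-mono n s each ⟩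
        ∑ᵛ n s (λ x → h * (F x ▸ common (Vec.lookup x)))    ≡⟨ ∑ᵛ-* n s h _ ⟩
        h * ∑ᵛ n s (λ x → F x ▸ common (Vec.lookup x))      ≡⟨ cong (h *_) regroup ⟩
        h * cliquesIn (suc s)                           ∎

    cliques-large : card U ^ suc r ≤ h ^ suc r * cliques (suc r)
    cliques-large = ≤-trans (cliquesIn-large (suc r) ≤-refl)
      (*-monoʳ-≤ (h ^ suc r) (∑ᵛ-mono n (suc r) λ x →
        ≤-trans (≤-reflexive (▸-∧ (allᶠ (λ i → U (Vec.lookup x i))) (sat d (pairs (suc r)) x) 1))
                (▸-≤ (allᶠ (λ i → U (Vec.lookup x i))) _)))

  module _ (t : ℕ) (few : h ^ suc r * cliques (suc r) < suc t ^ suc r) where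

    -- If every vertex of `U` had high degree, greedy extension would produce at least
    -- `(card U / h) ^ suc r` cliques, more than `few` allows once `card U > t`.
    low-degree : ∀ U → (∀ z → T (U z) → z < n) → t < card U →
      ∃ λ v → v < n × T (U v) × r * h * deg U v ≤ (r * h ∸ h′) * card U
    low-degree U U<n t<U
      with anyUpTo? (λ v → T? (U v) ×-dec (h′ * card U <? r * h * nondeg U v)) n
    ... | yes (v , v<n , Uv , big) = v , v<n , Uv , bound
      where
      open ≤-Reasoning
      bound : r * h * deg U v ≤ (r * h ∸ h′) * card U
      bound = begin
        r * h * deg U v                                     ≡⟨ m+n∸n≡m (r * h * deg U v) (r * h * nondeg U v) ⟨
        r * h * deg U v + r * h * nondeg U v ∸ r * h * nondeg U v
          ≡⟨ cong (_∸ r * h * nondeg U v)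
               (trans (sym (*-distribˡ-+ (r * h) (deg U v) (nondeg U v))) (cong (r * h *_) (deg+nondeg U v))) ⟩
        r * h * card U ∸ r * h * nondeg U v                 ≤⟨ ∸-monoʳ-≤ (r * h * card U) (<⇒≤ big) ⟩
        r * h * card U ∸ h′ * card U                        ≡⟨ *-distribʳ-∸ (card U) (r * h) h′ ⟨
        (r * h ∸ h′) * card U                               ∎
    ... | no none = contradiction
      (<-≤-trans few (^-monoˡ-≤ (suc r) t<U))
      (≤⇒≯ (cliques-large U λ z Uz → ≮⇒≥ λ lt → none (z , U<n z Uz , Uz , lt)))

    c : ℕ
    c = r * h ∸ h′

    delete : (ℕ → Bool) → ℕ → ℕ → Bool
    delete U v x = U x ∧ not (x ≡ᵇ v)

    card-delete : ∀ U v → v < n → T (U v) → card U ≡ suc (card (delete U v))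
    card-delete U v v<n Uv = trans (∑-cong n λ x _ → pt (U x) (x ≡ᵇ v))
      (trans (∑-+ n _ _) (cong (_+ card (delete U v)) (trans (∑-indicator n v _ v<n) (one (U v) Uv))))
      where
      pt : ∀ u e → u ▸ 1 ≡ e ▸ u ▸ 1 + (u ∧ not e) ▸ 1
      pt true  true  = refl
      pt true  false = refl
      pt false true  = refl
      pt false false = refl
      one : ∀ b → T b → b ▸ 1 ≡ 1
      one true _ = refl

    -- Only the row and the column of `v` are lost. A loop at `v` would be counted in both, which is
    -- one reason for an inequality.
    edges-delete : ∀ U v → v < n → edges U ≤ edges (delete U v) + (deg U v + deg U v)
    edges-delete U v v<n = begin
      edges U
        ≤⟨ ∑²-mono n (λ x y → pt (U x) (U y) (x ≡ᵇ v) (y ≡ᵇ v) (d x y)) ⟩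
      ∑² n (λ x y → (delete U v x ∧ delete U v y) ▸ d x y ▸ 1 + ((y ≡ᵇ v) ▸ U x ▸ d x y ▸ 1 + (x ≡ᵇ v) ▸ U y ▸ d x y ▸ 1))
        ≡⟨ trans (∑²-+ n _ _) (cong (edges (delete U v) +_) (∑²-+ n _ _)) ⟩
      edges (delete U v) + (∑² n (λ x y → (y ≡ᵇ v) ▸ U x ▸ d x y ▸ 1) + ∑² n (λ x y → (x ≡ᵇ v) ▸ U y ▸ d x y ▸ 1))
        ≡⟨ cong (edges (delete U v) +_) (cong₂ _+_ col row) ⟩
      edges (delete U v) + (deg U v + deg U v) ∎
      where
      open ≤-Reasoning
      pt : ∀ u w e f b → (u ∧ w) ▸ b ▸ 1 ≤ ((u ∧ not e) ∧ (w ∧ not f)) ▸ b ▸ 1 + (f ▸ u ▸ b ▸ 1 + e ▸ w ▸ b ▸ 1)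
      pt false w     e     f     b = z≤n
      pt true  false e     f     b = z≤n
      pt true  true  true  true  b = m≤m+n (b ▸ 1) (b ▸ 1)
      pt true  true  true  false b = ≤-refl
      pt true  true  false true  b = m≤m+n (b ▸ 1) 0
      pt true  true  false false b = m≤m+n (b ▸ 1) 0
      col : ∑² n (λ x y → (y ≡ᵇ v) ▸ U x ▸ d x y ▸ 1) ≡ deg U v
      col = ∑-cong n λ x _ → ∑-indicator n v (λ y → U x ▸ d x y ▸ 1) v<n
      row : ∑² n (λ x y → (x ≡ᵇ v) ▸ U y ▸ d x y ▸ 1) ≡ deg U v
      row = trans (∑²-swap n _) (∑-cong n λ y _ →
        trans (∑-indicator n v (λ x → U y ▸ d x y ▸ 1) v<n) (cong (λ b → U y ▸ b ▸ 1) (d-sym v y)))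

    edges≤card² : ∀ U → edges U ≤ card U * card U
    edges≤card² U = begin
      edges U                                             ≤⟨ ∑²-mono n (λ x y → pt (U x) (U y) (d x y)) ⟩
      ∑² n (λ x y → (U x ▸ 1) * (U y ▸ 1))                ≡⟨ ∑-cong n (λ x _ → ∑-* n (U x ▸ 1) _) ⟩
      ∑ n (λ x → (U x ▸ 1) * card U)                      ≡⟨ ∑-cong n (λ x _ → *-comm (U x ▸ 1) (card U)) ⟩
      ∑ n (λ x → card U * (U x ▸ 1))                      ≡⟨ ∑-* n (card U) _ ⟩
      card U * card U                                     ∎
      where
      open ≤-Reasoning
      pt : ∀ u w b → (u ∧ w) ▸ b ▸ 1 ≤ (u ▸ 1) * (w ▸ 1)
      pt false w     b = z≤n
      pt true  false b = z≤n
      pt true  true  b = ▸-≤ b 1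

    -- Induction on a bound `u` for the size. Deleting a vertex of low degree costs at most 2 c u /
    -- (r h) ordered pairs, and 2 u is the increment of u (u + 1). The deletions stop at size `t`,
    -- where t² bounds the pairs trivially.
    edges-bound : ∀ u U → (∀ z → T (U z) → z < n) → card U ≤ u →
      r * h * edges U ≤ c * (u * suc u) + r * h * (t * t)
    edges-bound u U U<n U≤u with card U ≤? t
    ... | yes U≤t = ≤-trans
      (*-monoʳ-≤ (r * h) (≤-trans (edges≤card² U) (*-mono-≤ U≤t U≤t)))
      (m≤n+m (r * h * (t * t)) (c * (u * suc u)))
    edges-bound zero U U<n U≤0 | no U≰t = contradiction (≤-trans U≤0 z≤n) U≰t
    edges-bound (suc u) U U<n U≤u | no U≰t
      with v , v<n , Uv , low ← low-degree U U<n (≰⇒> U≰t) = begin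
      r * h * edges U
        ≤⟨ *-monoʳ-≤ (r * h) (edges-delete U v v<n) ⟩
      r * h * (edges (delete U v) + (deg U v + deg U v))
        ≡⟨ e₁ (r * h) (edges (delete U v)) (deg U v) ⟩
      r * h * edges (delete U v) + (r * h * deg U v + r * h * deg U v)
        ≤⟨ +-mono-≤ (edges-bound u (delete U v) (λ z Dz → U<n z (proj₁ (T-∧⁻ Dz)))
                       (s≤s⁻¹ (subst (_≤ suc u) (card-delete U v v<n Uv) U≤u)))
                    (+-mono-≤ low′ low′) ⟩
      c * (u * suc u) + r * h * (t * t) + (c * suc u + c * suc u)
        ≡⟨ e₂ c u (r * h * (t * t)) ⟩
      c * (suc u * suc (suc u)) + r * h * (t * t) ∎
      where
      open ≤-Reasoning
      low′ : r * h * deg U v ≤ c * suc u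
      low′ = ≤-trans low (*-monoʳ-≤ c U≤u)
      e₁ : ∀ a b e → a * (b + (e + e)) ≡ a * b + (a * e + a * e)
      e₁ = solve-∀
      e₂ : ∀ c u z → c * (u * suc u) + z + (c * suc u + c * suc u) ≡ c * (suc u * suc (suc u)) + z
      e₂ = solve-∀

    total-edges-bound : r * h * ∑² n (bit▸ d) ≤ c * (n * suc n) + r * h * (t * t)
    total-edges-bound = subst (λ e → r * h * e ≤ c * (n * suc n) + r * h * (t * t)) eq
      (edges-bound n (_<ᵇ n) (λ z → <ᵇ⇒< z n)
        (≤-trans (∑-mono n λ x _ → ▸-≤ (x <ᵇ n) 1) (≤-reflexive (trans (∑-const n 1) (*-identityʳ n)))))
      where
      pt : ∀ a b v → T a → T b → (a ∧ b) ▸ v ≡ v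
      pt true true v _ _ = refl
      eq : edges (_<ᵇ n) ≡ ∑² n (bit▸ d)
      eq = ∑²-cong n λ x y x<n y<n → pt (x <ᵇ n) (y <ᵇ n) _ (<⇒<ᵇ x<n) (<⇒<ᵇ y<n)

-- Weak regularity

length-cartesianProductWith : ∀ {A B C : Set} (f : A → B → C) xs ys →
  length (cartesianProductWith f xs ys) ≡ length xs * length ys
length-cartesianProductWith f []       ys = refl
length-cartesianProductWith f (x ∷ xs) ys =
  trans (length-++ (map (f x) ys))
        (cong₂ _+_ (length-map (f x) ys) (length-cartesianProductWith f xs ys))

-- Sides of rectangles are turned into bit strings so that the steps can be enumerated. The default
-- `false` past the end is invisible to sums over indices below the length.
bit : List Bool → ℕ → Bool
bit []       i       = false
bit (b ∷ bs) zero    = b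
bit (b ∷ bs) (suc i) = bit bs i

bits : (ℕ → Bool) → ℕ → List Bool
bits p zero    = []
bits p (suc n) = p 0 ∷ bits (p ∘ suc) n

bit-bits : ∀ p n i → i < n → bit (bits p n) i ≡ p i
bit-bits p (suc n) zero    _         = refl
bit-bits p (suc n) (suc i) (s≤s i<n) = bit-bits (p ∘ suc) n i i<n

bits∈bitstrings : ∀ p n → bits p n ∈ bitstrings n
bits∈bitstrings p zero    = here refl
bits∈bitstrings p (suc n) with p 0
... | true  = ∈-++⁺ˡ (∈-map⁺ (true ∷_) (bits∈bitstrings (p ∘ suc) n))
... | false = ∈-++⁺ʳ (map (true ∷_) (bitstrings n)) (∈-map⁺ (false ∷_) (bits∈bitstrings (p ∘ suc) n))

length-bitstrings : ∀ n → length (bitstrings n) ≡ 2 ^ n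
length-bitstrings zero    = refl
length-bitstrings (suc n) = begin
  length (map (true ∷_) (bitstrings n) ++ map (false ∷_) (bitstrings n))
    ≡⟨ length-++ (map (true ∷_) (bitstrings n)) ⟩
  length (map (true ∷_) (bitstrings n)) + length (map (false ∷_) (bitstrings n))
    ≡⟨ cong₂ _+_ (length-map (true ∷_) (bitstrings n)) (length-map (false ∷_) (bitstrings n)) ⟩
  length (bitstrings n) + length (bitstrings n)
    ≡⟨ cong (λ z → z + z) (length-bitstrings n) ⟩
  2 ^ n + 2 ^ n
    ≡⟨ cong (2 ^ n +_) (+-identityʳ (2 ^ n)) ⟨
  2 ^ suc n ∎
  where open ≡-Reasoning

rect-bits : ∀ n A B f → rect n (bit (bits A n)) (bit (bits B n)) f ≡ rect n A B f
rect-bits n A B f = ∑²-cong n λ x y x<n y<n →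
  cong₂ (λ a b → (a ∧ b) ▸ f x y) (bit-bits A n x x<n) (bit-bits B n y y<n)

-- Encoding of weight updates.

data Step : Set where
  raise : Step
  lower : List Bool → List Bool → Step

Weight : Set
Weight = ℕ → ℕ → ℕ

steps : ℕ → List Step
steps n = raise ∷ cartesianProductWith lower (bitstrings n) (bitstrings n)

codes : ℕ → ℕ → List (List Step)
codes n zero    = [] ∷ []
codes n (suc t) = [] ∷ cartesianProductWith _∷_ (steps n) (codes n t)

-- The extra one pays for the empty code that `codes` admits at each level, so that `length-codes`
-- becomes a plain product.
length-steps : ∀ n .{{_ : NonZero n}} → suc (length (steps n)) ≤ 2 ^ suc (n + n)
length-steps n = begin
  2 + length (cartesianProductWith lower (bitstrings n) (bitstrings n))
    ≡⟨ cong (2 +_) (length-cartesianProductWith lower (bitstrings n) (bitstrings n)) ⟩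
  2 + length (bitstrings n) * length (bitstrings n)
    ≡⟨ cong (λ z → 2 + z * z) (length-bitstrings n) ⟩
  2 + 2 ^ n * 2 ^ n
    ≡⟨ cong (2 +_) (^-distribˡ-+-* 2 n n) ⟨
  2 + 2 ^ (n + n)
    ≤⟨ +-monoˡ-≤ (2 ^ (n + n)) (^-monoʳ-≤ 2 {1} {n + n} (≤-trans (>-nonZero⁻¹ n) (m≤m+n n n))) ⟩
  2 ^ (n + n) + 2 ^ (n + n)
    ≡⟨ cong (2 ^ (n + n) +_) (+-identityʳ (2 ^ (n + n))) ⟨
  2 ^ suc (n + n) ∎
  where open ≤-Reasoning

length-codes : ∀ n t .{{_ : NonZero n}} → length (codes n t) ≤ 2 ^ (suc (n + n) * t)
length-codes n zero    = ≤-reflexive (cong (2 ^_) (sym (*-zeroʳ (suc (n + n)))))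
length-codes n (suc t) = begin
  suc (length (cartesianProductWith _∷_ (steps n) (codes n t)))
    ≡⟨ cong suc (length-cartesianProductWith _∷_ (steps n) (codes n t)) ⟩
  suc (length (steps n) * length (codes n t))
    ≤⟨ +-mono-≤ (m^n>0 2 (suc (n + n) * t)) (*-monoʳ-≤ (length (steps n)) (length-codes n t)) ⟩
  suc (length (steps n)) * 2 ^ (suc (n + n) * t)
    ≤⟨ *-monoˡ-≤ (2 ^ (suc (n + n) * t)) (length-steps n) ⟩
  2 ^ suc (n + n) * 2 ^ (suc (n + n) * t)
    ≡⟨ ^-distribˡ-+-* 2 (suc (n + n)) (suc (n + n) * t) ⟨
  2 ^ (suc (n + n) + suc (n + n) * t)
    ≡⟨ cong (2 ^_) (*-suc (suc (n + n)) t) ⟨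
  2 ^ (suc (n + n) * suc t) ∎
  where open ≤-Reasoning

-- Decoding depends on `θ` and the code, never on the graph. This is what lets the number of codes
-- bound the number of containers.
module Run (θ : ℕ) where

  update : Step → Weight → Weight
  update raise       W x y = if W x y <ᵇ θ then suc (W x y) else W x y
  update (lower A B) W x y = if bit A x ∧ bit B y then pred (W x y) else W x y

  run : List Step → Weight → Weight
  run []       W = W
  run (s ∷ ss) W = run ss (update s W)

module Regularise (n θ H : ℕ) .{{_ : NonZero n}} .{{_ : NonZero θ}} .{{_ : NonZero H}}
  (g : ℕ → ℕ → Bool) where

  open Run θ

  M : ℕ
  M = θ * H

  θ≤M : θ ≤ M
  θ≤M = m≤m*n θ H

  Thin : Weight → Set
  Thin W = ∀ A B → rect n A B W ≤ M * rect n A B (bit▸ g) + n * n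

  light : Weight → ℕ
  light W = ∑² n λ x y → (W x y <ᵇ θ) ▸ bit▸ g x y

  -- W / M plays the role of a density, so light W counts the edges of g on pairs of density < 1 / H.
  record Regular (W : Weight) : Set where
    field
      thin      : Thin W
      few-light : H * light W ≤ n * n

  Bounded : Weight → Set
  Bounded W = ∀ x y → W x y ≤ M

  -- This is (M b - w)² with `b` read as 0 or 1, split into cases to stay in the naturals. Under
  -- `Bounded` the truncated subtraction is exact.
  pot : Bool → ℕ → ℕ
  pot b w = if b then (M ∸ w) * (M ∸ w) else w * w

  Φ : Weight → ℕ
  Φ W = ∑² n λ x y → pot (g x y) (W x y)

  -- Lowering `w` by one changes the square by 2 (M b - w) + 1. At `w = 0` the truncated `pred`
  -- changes nothing, whence an inequality.
  pot-pred : ∀ b w → w ≤ M → pot b (pred w) + 2 * w ≤ pot b w + (2 * (b ▸ M) + 1)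
  pot-pred b     zero    w≤M = +-monoʳ-≤ (pot b 0) z≤n
  pot-pred false (suc w) w≤M = ≤-reflexive (eq w)
    where
    eq : ∀ w → w * w + 2 * suc w ≡ suc w * suc w + (2 * 0 + 1)
    eq = solve-∀
  pot-pred true  (suc w) w<M = ≤-reflexive (begin
    (M ∸ w) * (M ∸ w) + 2 * suc w        ≡⟨ cong (λ z → z * z + 2 * suc w) (+-∸-assoc 1 w<M) ⟩
    suc c * suc c + 2 * suc w            ≡⟨ eq c w ⟩
    c * c + (2 * (suc w + c) + 1)        ≡⟨ cong (λ z → c * c + (2 * z + 1)) (m+[n∸m]≡n w<M) ⟩
    c * c + (2 * M + 1)                  ∎)
    where
    open ≡-Reasoning
    c = M ∸ suc w
    eq : ∀ c w → suc c * suc c + 2 * suc w ≡ c * c + (2 * (suc w + c) + 1)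
    eq = solve-∀

  pot-suc : ∀ b w → w < M → pot b (suc w) + 2 * (b ▸ M) ≡ pot b w + (2 * w + 1)
  pot-suc false w w<M = eq w
    where
    eq : ∀ w → suc w * suc w + 2 * 0 ≡ w * w + (2 * w + 1)
    eq = solve-∀
  pot-suc true  w w<M = begin
    c * c + 2 * M                        ≡⟨ cong (λ z → c * c + 2 * z) (m+[n∸m]≡n w<M) ⟨
    c * c + 2 * (suc w + c)              ≡⟨ eq c w ⟩
    suc c * suc c + (2 * w + 1)          ≡⟨ cong (λ z → z * z + (2 * w + 1)) (+-∸-assoc 1 w<M) ⟨
    (M ∸ w) * (M ∸ w) + (2 * w + 1)      ∎
    where
    open ≡-Reasoning
    c = M ∸ suc w
    eq : ∀ c w → c * c + 2 * (suc w + c) ≡ suc c * suc c + (2 * w + 1)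
    eq = solve-∀

  update-bounded : ∀ s {W} → Bounded W → Bounded (update s W)
  update-bounded raise {W} W≤M x y with W x y <ᵇ θ in eq
  ... | false = W≤M x y
  ... | true  = ≤-trans (<ᵇ⇒< (W x y) θ (subst T (sym eq) _)) θ≤M
  update-bounded (lower A B) {W} W≤M x y with bit A x ∧ bit B y
  ... | false = W≤M x y
  ... | true  = ≤-trans pred[n]≤n (W≤M x y)

  -- Summed over the rectangle, the linear terms gain twice the excess of `W` over `M` times the
  -- edges, which is more than 2 n². The quadratic terms cost at most one per pair, n² in all.
  Φ-lower : ∀ A B {W} → Bounded W →
    M * rect n (bit A) (bit B) (bit▸ g) + n * n < rect n (bit A) (bit B) W →
    Φ (update (lower A B) W) + n * n ≤ Φ W
  Φ-lower A B {W} W≤M heavy = +-cancelʳ-≤ (2 * (M * e) + n * n) _ _ (begin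
    Φ W′ + n * n + (2 * (M * e) + n * n)       ≡⟨ eq₁ (Φ W′) (n * n) (M * e) ⟩
    Φ W′ + 2 * (M * e + n * n)                 ≤⟨ +-monoʳ-≤ (Φ W′) (*-monoʳ-≤ 2 (<⇒≤ heavy)) ⟩
    Φ W′ + 2 * rect n (bit A) (bit B) W        ≡⟨ cong (Φ W′ +_) (∑²-* n 2 _) ⟨
    Φ W′ + ∑² n (λ x y → 2 * (k x y ▸ W x y))  ≡⟨ ∑²-+ n _ _ ⟨
    ∑² n (λ x y → pot (g x y) (W′ x y) + 2 * (k x y ▸ W x y))
      ≤⟨ ∑²-mono n pt ⟩
    ∑² n (λ x y → pot (g x y) (W x y) + (2 * (M * (k x y ▸ g x y ▸ 1)) + 1))
      ≡⟨ trans (∑²-+ n _ _) (cong (Φ W +_) (trans (∑²-+ n _ _)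
           (cong₂ _+_ (trans (∑²-* n 2 _) (cong (2 *_) (∑²-* n M _))) (trans (∑²-const n 1) (*-identityʳ (n * n)))))) ⟩
    Φ W + (2 * (M * e) + n * n)                ∎)
    where
    open ≤-Reasoning
    W′ = update (lower A B) W
    e = rect n (bit A) (bit B) (bit▸ g)
    k : ℕ → ℕ → Bool
    k x y = bit A x ∧ bit B y
    eq₁ : ∀ p q z → p + q + (2 * z + q) ≡ p + 2 * (z + q)
    eq₁ = solve-∀
    pt : ∀ x y → pot (g x y) (W′ x y) + 2 * (k x y ▸ W x y) ≤
      pot (g x y) (W x y) + (2 * (M * (k x y ▸ g x y ▸ 1)) + 1)
    pt x y with bit A x ∧ bit B y
    ... | true  = ≤-trans (pot-pred (g x y) (W x y) (W≤M x y))
      (≤-reflexive (cong (λ z → pot (g x y) (W x y) + (2 * z + 1)) (▸-* (g x y) M)))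
    ... | false = +-monoʳ-≤ (pot (g x y) (W x y)) z≤n

  -- Raising from w < θ costs 2 w + 1 ≤ 2 θ - 1 and regains 2 M on an edge. The light edges give
  -- back 2 M times `light W`, which equals 2 θ H times `light W` and exceeds 2 θ n²; so a drop of
  -- n² remains.
  Φ-raise : ∀ {W} → Bounded W → n * n < H * light W → Φ (update raise W) + n * n ≤ Φ W
  Φ-raise {W} W≤M many = +-cancelʳ-≤ (2 * (θ * (n * n))) _ _ (begin
    Φ W′ + n * n + 2 * (θ * (n * n))
      ≤⟨ +-monoʳ-≤ (Φ W′ + n * n) (*-monoʳ-≤ 2 (*-monoʳ-≤ θ (<⇒≤ many))) ⟩
    Φ W′ + n * n + 2 * (θ * (H * light W))
      ≡⟨ cong (λ z → Φ W′ + n * n + 2 * z) (*-assoc θ H (light W)) ⟨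
    Φ W′ + n * n + 2 * (M * light W)
      ≡⟨ cong₂ (λ y z → Φ W′ + y + z) (trans (∑²-const n 1) (*-identityʳ (n * n)))
           (trans (∑²-* n 2 _) (cong (2 *_) (∑²-* n M _))) ⟨
    Φ W′ + ∑² n (λ _ _ → 1) + ∑² n (λ x y → 2 * (M * (k x y ▸ g x y ▸ 1)))
      ≡⟨ trans (∑²-+ n _ _) (cong (_+ ∑² n (λ x y → 2 * (M * (k x y ▸ g x y ▸ 1)))) (∑²-+ n _ _)) ⟨
    ∑² n (λ x y → pot (g x y) (W′ x y) + 1 + 2 * (M * (k x y ▸ g x y ▸ 1)))
      ≤⟨ ∑²-mono n pt ⟩
    ∑² n (λ x y → pot (g x y) (W x y) + 2 * θ)
      ≡⟨ trans (∑²-+ n _ _) (cong (Φ W +_) (trans (∑²-const n (2 * θ)) (eq₁ (n * n) θ))) ⟩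
    Φ W + 2 * (θ * (n * n)) ∎)
    where
    open ≤-Reasoning
    W′ = update raise W
    k : ℕ → ℕ → Bool
    k x y = W x y <ᵇ θ
    eq₁ : ∀ q t → q * (2 * t) ≡ 2 * (t * q)
    eq₁ = solve-∀
    eq₂ : ∀ p z → p + 1 + z ≡ p + z + 1
    eq₂ = solve-∀
    eq₃ : ∀ p w → p + (2 * w + 1) + 1 ≡ p + 2 * suc w
    eq₃ = solve-∀
    pt : ∀ x y → pot (g x y) (W′ x y) + 1 + 2 * (M * (k x y ▸ g x y ▸ 1)) ≤ pot (g x y) (W x y) + 2 * θ
    pt x y with W x y <ᵇ θ in eq
    ... | true  = begin
      pot (g x y) (suc (W x y)) + 1 + 2 * (M * (g x y ▸ 1))
        ≡⟨ cong (λ z → pot (g x y) (suc (W x y)) + 1 + 2 * z) (▸-* (g x y) M) ⟨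
      pot (g x y) (suc (W x y)) + 1 + 2 * (g x y ▸ M)
        ≡⟨ eq₂ (pot (g x y) (suc (W x y))) _ ⟩
      pot (g x y) (suc (W x y)) + 2 * (g x y ▸ M) + 1
        ≡⟨ cong (_+ 1) (pot-suc (g x y) (W x y) (<-≤-trans W<θ θ≤M)) ⟩
      pot (g x y) (W x y) + (2 * W x y + 1) + 1
        ≡⟨ eq₃ (pot (g x y) (W x y)) (W x y) ⟩
      pot (g x y) (W x y) + 2 * suc (W x y)
        ≤⟨ +-monoʳ-≤ (pot (g x y) (W x y)) (*-monoʳ-≤ 2 W<θ) ⟩
      pot (g x y) (W x y) + 2 * θ ∎
      where
      W<θ : W x y < θ
      W<θ = <ᵇ⇒< (W x y) θ (subst T (sym eq) _)
    ... | false = begin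
      pot (g x y) (W x y) + 1 + 2 * (M * 0)
        ≡⟨ cong (λ z → pot (g x y) (W x y) + 1 + 2 * z) (*-zeroʳ M) ⟩
      pot (g x y) (W x y) + 1 + 0    ≡⟨ +-identityʳ _ ⟩
      pot (g x y) (W x y) + 1        ≤⟨ +-monoʳ-≤ (pot (g x y) (W x y)) (≤-trans (>-nonZero⁻¹ θ) (m≤n*m θ 2)) ⟩
      pot (g x y) (W x y) + 2 * θ    ∎

  Improvable : Weight → Set
  Improvable W = ∃ λ s → s ∈ steps n × Φ (update s W) + n * n ≤ Φ W

  data Outcome (W : Weight) : Set where
    regular   : Regular W → Outcome W
    improving : Improvable W → Outcome W

  outcome : ∀ {W} → Bounded W → Outcome W
  outcome {W} W≤M with H * light W ≤? n * n
  ... | no many = improving (raise , here refl , Φ-raise W≤M (≰⇒> many))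
  ... | yes few-light
    -- Searching finitely many bit strings settles thinness for all predicates, since a rectangle
    -- sum sees only indices below `n`.
    with any? (λ A → any? (λ B →
           M * rect n (bit A) (bit B) (bit▸ g) + n * n <? rect n (bit A) (bit B) W) (bitstrings n)) (bitstrings n)
  ...   | yes heavy with A , A∈ , heavyA ← find heavy with B , B∈ , heavyAB ← find heavyA =
    improving (lower A B , there (∈-cartesianProductWith⁺ lower A∈ B∈) , Φ-lower A B W≤M heavyAB)
  ...   | no ¬heavy = regular (record { thin = thin ; few-light = few-light })
    where
    thin : Thin W
    thin A B = subst₂ (λ p q → p ≤ M * q + n * n) (rect-bits n A B W) (rect-bits n A B (bit▸ g))
      (≮⇒≥ λ heavy → ¬heavy (lose (bits∈bitstrings A n) (lose (bits∈bitstrings B n) heavy)))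

  -- `t` bounds the number of improvements still possible: each lowers `Φ` by n², and a `Φ` below n²
  -- admits none.
  regularise : ∀ t {W} → Bounded W → Φ W < suc t * (n * n) →
    ∃ λ c → c ∈ codes n t × Regular (run c W)
  regularise t {W} W≤M Φ< with outcome W≤M
  regularise zero    W≤M Φ< | regular reg = [] , here refl , reg
  regularise (suc t) W≤M Φ< | regular reg = [] , here refl , reg
  regularise zero    {W} W≤M Φ< | improving (s , _ , drop) = contradiction Φ<
    (≤⇒≯ (≤-trans (≤-reflexive (+-identityʳ (n * n))) (≤-trans (m≤n+m (n * n) _) drop)))
  regularise (suc t) {W} W≤M Φ< | improving (s , s∈ , drop)
    with c , c∈ , reg ← regularise t (update-bounded s W≤M)
           (+-cancelˡ-< (n * n) _ _ (≤-<-trans (≤-trans (≤-reflexive (+-comm (n * n) _)) drop) Φ<)) =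
    s ∷ c , there (∈-cartesianProductWith⁺ _∷_ s∈ c∈) , reg

  regular-code : ∃ λ c → c ∈ codes n (M * M) × Regular (run c (λ _ _ → 0))
  regular-code = regularise (M * M) (λ _ _ → z≤n) (begin-strict
    Φ (λ _ _ → 0)                   ≤⟨ ∑²-mono n (λ x y → pot₀ (g x y)) ⟩
    ∑² n (λ _ _ → M * M)            ≡⟨ trans (∑²-const n (M * M)) (*-comm (n * n) (M * M)) ⟩
    M * M * (n * n)                 <⟨ m<n+m (M * M * (n * n)) (>-nonZero⁻¹ (n * n) {{m*n≢0 n n}}) ⟩
    suc (M * M) * (n * n)           ∎)
    where
    open ≤-Reasoning
    pot₀ : ∀ b → pot b 0 ≤ M * M
    pot₀ true  = ≤-refl
    pot₀ false = z≤n

-- Bit strings almost contained in a mask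

∑ᴸ : ∀ {A : Set} → (A → ℕ) → List A → ℕ
∑ᴸ f []       = 0
∑ᴸ f (x ∷ xs) = f x + ∑ᴸ f xs

count : ∀ {A : Set} → (A → Bool) → List A → ℕ
count p = ∑ᴸ λ x → p x ▸ 1

∑ᴸ-++ : ∀ {A : Set} (f : A → ℕ) xs ys → ∑ᴸ f (xs ++ ys) ≡ ∑ᴸ f xs + ∑ᴸ f ys
∑ᴸ-++ f []       ys = refl
∑ᴸ-++ f (x ∷ xs) ys = trans (cong (f x +_) (∑ᴸ-++ f xs ys)) (sym (+-assoc (f x) _ _))

∑ᴸ-map : ∀ {A B : Set} (f : B → ℕ) (h : A → B) xs → ∑ᴸ f (map h xs) ≡ ∑ᴸ (f ∘ h) xs
∑ᴸ-map f h []       = refl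
∑ᴸ-map f h (x ∷ xs) = cong (f (h x) +_) (∑ᴸ-map f h xs)

∑ᴸ-mono-∈ : ∀ {A : Set} {f g : A → ℕ} xs → (∀ x → x ∈ xs → f x ≤ g x) → ∑ᴸ f xs ≤ ∑ᴸ g xs
∑ᴸ-mono-∈ []       f≤g = z≤n
∑ᴸ-mono-∈ (x ∷ xs) f≤g = +-mono-≤ (f≤g x (here refl)) (∑ᴸ-mono-∈ xs λ y y∈ → f≤g y (there y∈))

∑ᴸ-+ : ∀ {A : Set} (f g : A → ℕ) xs → ∑ᴸ (λ x → f x + g x) xs ≡ ∑ᴸ f xs + ∑ᴸ g xs
∑ᴸ-+ f g []       = refl
∑ᴸ-+ f g (x ∷ xs) =
  trans (cong (f x + g x +_) (∑ᴸ-+ f g xs)) (+-interchange (f x) (g x) (∑ᴸ f xs) (∑ᴸ g xs))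

∑ᴸ-zero : ∀ {A : Set} (xs : List A) → ∑ᴸ (λ _ → 0) xs ≡ 0
∑ᴸ-zero []       = refl
∑ᴸ-zero (x ∷ xs) = ∑ᴸ-zero xs

length-filterᵇ : ∀ {A : Set} (p : A → Bool) xs → length (filterᵇ p xs) ≡ count p xs
length-filterᵇ p []       = refl
length-filterᵇ p (x ∷ xs) with p x
... | true  = cong suc (length-filterᵇ p xs)
... | false = length-filterᵇ p xs

count-mono-∈ : ∀ {A : Set} {p q : A → Bool} xs →
  (∀ x → x ∈ xs → T (p x) → T (q x)) → count p xs ≤ count q xs
count-mono-∈ {p = p} {q} xs p⊆q = ∑ᴸ-mono-∈ xs λ x x∈ → pt (p x) (q x) (p⊆q x x∈)
  where
  pt : ∀ a b → (T a → T b) → a ▸ 1 ≤ b ▸ 1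
  pt false b     _   = z≤n
  pt true  true  _   = ≤-refl
  pt true  false a⊆b = contradiction _ a⊆b

-- A union bound: whatever the head of `cs` catches is removed from `p`, and the tail covers the
-- rest.
count-cover : ∀ {A C : Set} (q : C → A → Bool) K (xs : List A) →
  (∀ c → count (q c) xs ≤ K) → ∀ cs (p : A → Bool) →
  (∀ x → x ∈ xs → T (p x) → ∃ λ c → c ∈ cs × T (q c x)) →
  count p xs ≤ length cs * K
count-cover q K xs q≤K [] p cover =
  ≤-trans (count-mono-∈ {q = λ _ → false} xs λ x x∈ px → none (cover x x∈ px)) (≤-reflexive (∑ᴸ-zero xs))
  where
  none : ∀ {x} → (∃ λ c → c ∈ [] × T (q c x)) → T false
  none (_ , () , _)
count-cover {A} q K xs q≤K (c ∷ cs) p cover = begin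
  count p xs
    ≤⟨ ∑ᴸ-mono-∈ xs (λ x _ → pt (p x) (q c x)) ⟩
  ∑ᴸ (λ x → q c x ▸ 1 + (p x ∧ not (q c x)) ▸ 1) xs
    ≡⟨ ∑ᴸ-+ _ _ xs ⟩
  count (q c) xs + count rest xs
    ≤⟨ +-mono-≤ (q≤K c) (count-cover q K xs q≤K cs rest cover′) ⟩
  K + length cs * K ∎
  where
  open ≤-Reasoning
  rest : A → Bool
  rest x = p x ∧ not (q c x)
  pt : ∀ a b → a ▸ 1 ≤ b ▸ 1 + (a ∧ not b) ▸ 1
  pt false b     = z≤n
  pt true  true  = ≤-refl
  pt true  false = ≤-refl
  split : ∀ a b → T (a ∧ not b) → T a × ¬ T b
  split true false _ = _ , λ ()
  cover′ : ∀ x → x ∈ xs → T (rest x) → ∃ λ c′ → c′ ∈ cs × T (q c′ x)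
  cover′ x x∈ t with px , ¬qcx ← split (p x) (q c x) t with cover x x∈ px
  ... | c′ , here refl , qx = contradiction qx ¬qcx
  ... | c′ , there c′∈ , qx = c′ , c′∈ , qx

outside : List Bool → List Bool → ℕ
outside (true  ∷ ms) (b ∷ bs) = outside ms bs
outside (false ∷ ms) (b ∷ bs) = b ▸ 1 + outside ms bs
outside _            _        = 0

ones zeros : List Bool → ℕ
ones  = ∑ᴸ (_▸ 1)
zeros = ∑ᴸ λ b → not b ▸ 1

-- With a strict bound, `k = 0` counts nothing; this is the boundary value for the Pascal-type
-- recursion `strings-false`.
strings : List Bool → ℕ → ℕ
strings ms k = count (λ bs → outside ms bs <ᵇ k) (bitstrings (length ms))

count-bitstrings-suc : ∀ (p : List Bool → Bool) n →
  count p (bitstrings (suc n)) ≡ count (p ∘ (true ∷_)) (bitstrings n) + count (p ∘ (false ∷_)) (bitstrings n)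
count-bitstrings-suc p n =
  trans (∑ᴸ-++ _ (map (true ∷_) (bitstrings n)) (map (false ∷_) (bitstrings n)))
        (cong₂ _+_ (∑ᴸ-map _ (true ∷_) (bitstrings n)) (∑ᴸ-map _ (false ∷_) (bitstrings n)))

strings-zero : ∀ ms → strings ms 0 ≡ 0
strings-zero ms = ∑ᴸ-zero (bitstrings (length ms))

strings-true : ∀ ms k → strings (true ∷ ms) k ≡ strings ms k + strings ms k
strings-true ms k = count-bitstrings-suc (λ bs → outside (true ∷ ms) bs <ᵇ k) (length ms)

strings-false : ∀ ms k → strings (false ∷ ms) (suc k) ≡ strings ms k + strings ms (suc k)
strings-false ms k = count-bitstrings-suc (λ bs → outside (false ∷ ms) bs <ᵇ suc k) (length ms)

strings-≥ : ∀ ms → 2 ^ ones ms ≤ strings ms 1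
strings-≥ []           = ≤-refl
strings-≥ (true ∷ ms)  = begin
  2 ^ ones ms + (2 ^ ones ms + 0)  ≡⟨ cong (2 ^ ones ms +_) (+-identityʳ (2 ^ ones ms)) ⟩
  2 ^ ones ms + 2 ^ ones ms        ≤⟨ +-mono-≤ (strings-≥ ms) (strings-≥ ms) ⟩
  strings ms 1 + strings ms 1      ≡⟨ strings-true ms 1 ⟨
  strings (true ∷ ms) 1            ∎
  where open ≤-Reasoning
strings-≥ (false ∷ ms) = begin
  2 ^ ones ms                      ≤⟨ strings-≥ ms ⟩
  strings ms 1                     ≤⟨ m≤n+m (strings ms 1) (strings ms 0) ⟩
  strings ms 0 + strings ms 1      ≡⟨ strings-false ms 0 ⟨
  strings (false ∷ ms) 1           ∎
  where open ≤-Reasoning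

-- Chernoff-style: a string with i ones outside the mask is given weight y ^ (m − i) ≥ 1.
strings-≤ : ∀ y .{{_ : NonZero y}} ms m →
  strings ms (suc m) * y ^ zeros ms ≤ 2 ^ ones ms * (y ^ m * suc y ^ zeros ms)
strings-≤ y [] m =
  ≤-trans (m^n>0 y m) (≤-reflexive (sym (trans (+-identityʳ (y ^ m * 1)) (*-identityʳ (y ^ m)))))
strings-≤ y (true ∷ ms) m = begin
  strings (true ∷ ms) (suc m) * y ^ z                  ≡⟨ cong (_* y ^ z) (strings-true ms (suc m)) ⟩
  (strings ms (suc m) + strings ms (suc m)) * y ^ z    ≡⟨ eq₁ (strings ms (suc m)) (y ^ z) ⟩
  2 * (strings ms (suc m) * y ^ z)                     ≤⟨ *-monoʳ-≤ 2 (strings-≤ y ms m) ⟩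
  2 * (2 ^ ones ms * (y ^ m * suc y ^ z))              ≡⟨ *-assoc 2 (2 ^ ones ms) _ ⟨
  2 * 2 ^ ones ms * (y ^ m * suc y ^ z)                ∎
  where
  open ≤-Reasoning
  z = zeros ms
  eq₁ : ∀ s p → (s + s) * p ≡ 2 * (s * p)
  eq₁ = solve-∀
strings-≤ y (false ∷ ms) zero = begin
  strings (false ∷ ms) 1 * (y * y ^ z)
    ≡⟨ cong (_* (y * y ^ z)) (trans (strings-false ms 0) (cong (_+ strings ms 1) (strings-zero ms))) ⟩
  strings ms 1 * (y * y ^ z)                 ≡⟨ eq₁ (strings ms 1) y (y ^ z) ⟩
  y * (strings ms 1 * y ^ z)                 ≤⟨ *-mono-≤ (n≤1+n y) (strings-≤ y ms 0) ⟩
  suc y * (2 ^ ones ms * (1 * suc y ^ z))    ≡⟨ eq₂ (suc y) (2 ^ ones ms) (suc y ^ z) ⟩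
  2 ^ ones ms * (1 * (suc y * suc y ^ z))    ∎
  where
  open ≤-Reasoning
  z = zeros ms
  eq₁ : ∀ s p q → s * (p * q) ≡ p * (s * q)
  eq₁ = solve-∀
  eq₂ : ∀ s p q → s * (p * (1 * q)) ≡ p * (1 * (s * q))
  eq₂ = solve-∀
strings-≤ y (false ∷ ms) (suc m) = begin
  strings (false ∷ ms) (2 + m) * (y * y ^ z)
    ≡⟨ cong (_* (y * y ^ z)) (strings-false ms (suc m)) ⟩
  (strings ms (suc m) + strings ms (2 + m)) * (y * y ^ z)
    ≡⟨ eq₁ (strings ms (suc m)) (strings ms (2 + m)) y (y ^ z) ⟩
  y * (strings ms (suc m) * y ^ z) + y * (strings ms (2 + m) * y ^ z)
    ≤⟨ +-mono-≤ (*-monoʳ-≤ y (strings-≤ y ms m)) (*-monoʳ-≤ y (strings-≤ y ms (suc m))) ⟩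
  y * (2 ^ ones ms * (y ^ m * suc y ^ z)) + y * (2 ^ ones ms * (y * y ^ m * suc y ^ z))
    ≡⟨ eq₂ y (2 ^ ones ms) (y ^ m) (suc y ^ z) ⟩
  2 ^ ones ms * (y * y ^ m * (suc y * suc y ^ z)) ∎
  where
  open ≤-Reasoning
  z = zeros ms
  eq₁ : ∀ s t p q → (s + t) * (p * q) ≡ p * (s * q) + p * (t * q)
  eq₁ = solve-∀
  eq₂ : ∀ y e p q → y * (e * (p * q)) + y * (e * (y * p * q)) ≡ e * (y * p * (suc y * q))
  eq₂ = solve-∀

-- Estimates for powers of 1 + 1/y.

^-distribʳ-* : ∀ t a b → (a * b) ^ t ≡ a ^ t * b ^ t
^-distribʳ-* zero    a b = refl
^-distribʳ-* (suc t) a b = trans (cong (a * b *_) (^-distribʳ-* t a b)) (eq a b (a ^ t) (b ^ t))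
  where
  eq : ∀ a b p q → a * b * (p * q) ≡ a * p * (b * q)
  eq = solve-∀

-- Bernoulli's inequality (1 - 1/(a+1))^j ≥ 1 - j/(a+1), multiplied out. The variable `b` stands for
-- a + 1 - j and keeps subtraction out of the induction.
bernoulli : ∀ a j b → j + b ≡ suc a → suc a ^ j * b ≤ a ^ j * suc a
bernoulli a zero    b eq = ≤-reflexive (cong (_+ 0) eq)
bernoulli a (suc j) b eq = begin
  suc a * suc a ^ j * b         ≡⟨ eq₁ (suc a) (suc a ^ j) b ⟩
  suc a ^ j * (b + a * b)       ≤⟨ *-monoʳ-≤ (suc a ^ j) (+-monoˡ-≤ (a * b) b≤a) ⟩
  suc a ^ j * (a + a * b)       ≡⟨ eq₂ (suc a ^ j) a b ⟩
  a * (suc a ^ j * suc b)       ≤⟨ *-monoʳ-≤ a (bernoulli a j (suc b) (trans (+-suc j b) eq)) ⟩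
  a * (a ^ j * suc a)           ≡⟨ *-assoc a (a ^ j) (suc a) ⟨
  a * a ^ j * suc a             ∎
  where
  open ≤-Reasoning
  b≤a : b ≤ a
  b≤a = ≤-trans (m≤n+m b j) (≤-reflexive (suc-injective eq))
  eq₁ : ∀ s p b → s * p * b ≡ p * (s * b)
  eq₁ = solve-∀
  eq₂ : ∀ p a b → p * (a + a * b) ≡ a * (p * suc b)
  eq₂ = solve-∀

[1+2w]^w≤2[2w]^w : ∀ w → suc (2 * w) ^ w ≤ 2 * (2 * w) ^ w
[1+2w]^w≤2[2w]^w w = *-cancelʳ-≤ _ _ (suc w) (begin
  suc (2 * w) ^ w * suc w       ≤⟨ bernoulli (2 * w) w (suc w) (eq₁ w) ⟩
  (2 * w) ^ w * suc (2 * w)     ≤⟨ *-monoʳ-≤ ((2 * w) ^ w) (≤-trans (n≤1+n _) (≤-reflexive (eq₂ w))) ⟩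
  (2 * w) ^ w * (2 * suc w)     ≡⟨ eq₃ ((2 * w) ^ w) (suc w) ⟩
  2 * (2 * w) ^ w * suc w       ∎)
  where
  open ≤-Reasoning
  eq₁ : ∀ w → w + suc w ≡ suc (2 * w)
  eq₁ = solve-∀
  eq₂ : ∀ w → suc (suc (2 * w)) ≡ 2 * suc w
  eq₂ = solve-∀
  eq₃ : ∀ p s → p * (2 * s) ≡ 2 * p * s
  eq₃ = solve-∀

-- A crude form of (1 + 1/y)^z ≤ e^(z/y) for even y = 2w.
[1+2w]^z≤2^t[2w]^z : ∀ w .{{_ : NonZero w}} z t → z ≤ w * t → suc (2 * w) ^ z ≤ 2 ^ t * (2 * w) ^ z
[1+2w]^z≤2^t[2w]^z w z t z≤wt = *-cancelʳ-≤ _ _ (y ^ e) {{m^n≢0 y e {{m*n≢0 2 w}}}} (begin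
  -- Multiplying by `y ^ e` fills the exponent up to `w * t`, that is, to `t` blocks of length `w`,
  -- each worth a factor 2.
  suc y ^ z * y ^ e         ≤⟨ *-monoʳ-≤ (suc y ^ z) (^-monoˡ-≤ e (n≤1+n y)) ⟩
  suc y ^ z * suc y ^ e     ≡⟨ ^-distribˡ-+-* (suc y) z e ⟨
  suc y ^ (z + e)           ≡⟨ cong (suc y ^_) z+e ⟩
  suc y ^ (w * t)           ≡⟨ ^-*-assoc (suc y) w t ⟨
  (suc y ^ w) ^ t           ≤⟨ ^-monoˡ-≤ t ([1+2w]^w≤2[2w]^w w) ⟩
  (2 * y ^ w) ^ t           ≡⟨ ^-distribʳ-* t 2 (y ^ w) ⟩
  2 ^ t * (y ^ w) ^ t       ≡⟨ cong (2 ^ t *_) (^-*-assoc y w t) ⟩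
  2 ^ t * y ^ (w * t)       ≡⟨ cong (λ q → 2 ^ t * y ^ q) z+e ⟨
  2 ^ t * y ^ (z + e)       ≡⟨ cong (2 ^ t *_) (^-distribˡ-+-* y z e) ⟩
  2 ^ t * (y ^ z * y ^ e)   ≡⟨ *-assoc (2 ^ t) (y ^ z) (y ^ e) ⟨
  2 ^ t * y ^ z * y ^ e     ∎)
  where
  open ≤-Reasoning
  y = 2 * w
  e = w * t ∸ z
  z+e : z + e ≡ w * t
  z+e = m+[n∸m]≡n z≤wt

-- The weight y = 2^(q+1) makes both losses powers of two: `y ^ m` costs `suc q * m` bits, and (1 +
-- 1/y) to the power `zeros ms` costs at most `t` bits because `zeros ms` is at most t y / 2.
strings-bound : ∀ q ms m t → zeros ms ≤ 2 ^ q * t →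
  strings ms (suc m) ≤ 2 ^ (ones ms + (suc q * m + t))
strings-bound q ms m t z≤ = *-cancelʳ-≤ _ _ (y ^ z) {{m^n≢0 y z {{m^n≢0 2 (suc q)}}}} (begin
  strings ms (suc m) * y ^ z                      ≤⟨ strings-≤ y {{m^n≢0 2 (suc q)}} ms m ⟩
  2 ^ ones ms * (y ^ m * suc y ^ z)
    ≤⟨ *-monoʳ-≤ (2 ^ ones ms) (*-monoʳ-≤ (y ^ m) ([1+2w]^z≤2^t[2w]^z (2 ^ q) {{m^n≢0 2 q}} z t z≤)) ⟩
  2 ^ ones ms * (y ^ m * (2 ^ t * y ^ z))
    ≡⟨ eq (2 ^ ones ms) (y ^ m) (2 ^ t) (y ^ z) ⟩
  2 ^ ones ms * (y ^ m * 2 ^ t) * y ^ z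
    ≡⟨ cong (λ p → 2 ^ ones ms * (p * 2 ^ t) * y ^ z) (^-*-assoc 2 (suc q) m) ⟩
  2 ^ ones ms * (2 ^ (suc q * m) * 2 ^ t) * y ^ z
    ≡⟨ cong (λ p → 2 ^ ones ms * p * y ^ z) (^-distribˡ-+-* 2 (suc q * m) t) ⟨
  2 ^ ones ms * 2 ^ (suc q * m + t) * y ^ z
    ≡⟨ cong (_* y ^ z) (^-distribˡ-+-* 2 (ones ms) (suc q * m + t)) ⟨
  2 ^ (ones ms + (suc q * m + t)) * y ^ z         ∎)
  where
  open ≤-Reasoning
  y = 2 ^ suc q
  z = zeros ms
  eq : ∀ a b c d → a * (b * (c * d)) ≡ a * (b * c) * d
  eq = solve-∀

-- Sums over vertex pairs.

∑ᴸ-upTo : ∀ f n → ∑ᴸ f (upTo n) ≡ ∑ n f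
∑ᴸ-upTo f zero    = refl
∑ᴸ-upTo f (suc n) = begin
  ∑ᴸ f (upTo (suc n))               ≡⟨ cong (∑ᴸ f) (upTo-∷ʳ n) ⟨
  ∑ᴸ f (upTo n ∷ʳ n)                ≡⟨ ∑ᴸ-++ f (upTo n) (n ∷ []) ⟩
  ∑ᴸ f (upTo n) + (f n + 0)         ≡⟨ cong₂ _+_ (∑ᴸ-upTo f n) (+-identityʳ (f n)) ⟩
  ∑ n f + f n                       ∎
  where open ≡-Reasoning

∑ᴸ-vertexPairs : ∀ F n → ∑ᴸ F (vertexPairs n) ≡ ∑ n λ j → ∑ j λ i → F (i , j)
∑ᴸ-vertexPairs F n = trans (∑ᴸ-concatMap (upTo n)) (∑ᴸ-upTo (λ j → ∑ j λ i → F (i , j)) n)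
  where
  row : ℕ → List (ℕ × ℕ)
  row j = map (λ i → (i , j)) (upTo j)
  ∑ᴸ-concatMap : ∀ js → ∑ᴸ F (concatMap row js) ≡ ∑ᴸ (λ j → ∑ j λ i → F (i , j)) js
  ∑ᴸ-concatMap []       = refl
  ∑ᴸ-concatMap (j ∷ js) = trans (∑ᴸ-++ F (row j) (concatMap row js))
    (cong₂ _+_ (trans (∑ᴸ-map F (λ i → (i , j)) (upTo j)) (∑ᴸ-upTo (λ i → F (i , j)) j)) (∑ᴸ-concatMap js))

-- Every unordered pair contributes both of its orders to the square; what is dropped is the
-- diagonal.
∑-triangle : ∀ n (f : ℕ → ℕ → ℕ) → ∑ n (λ j → ∑ j λ i → f i j + f j i) ≤ ∑² n f
∑-triangle zero    f = z≤n
∑-triangle (suc n) f = begin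
  ∑ n (λ j → ∑ j λ i → f i j + f j i) + ∑ n (λ i → f i n + f n i)
    ≤⟨ +-mono-≤ (∑-triangle n f) (≤-reflexive (∑-+ n _ _)) ⟩
  ∑² n f + (∑ n (λ i → f i n) + ∑ n (f n))
    ≡⟨ +-assoc (∑² n f) _ _ ⟨
  ∑² n f + ∑ n (λ i → f i n) + ∑ n (f n)
    ≡⟨ cong (_+ ∑ n (f n)) (∑-+ n _ _) ⟨
  ∑ n (λ x → ∑ n (f x) + f x n) + ∑ n (f n)
    ≤⟨ +-monoʳ-≤ (∑ n (λ x → ∑ n (f x) + f x n)) (m≤m+n (∑ n (f n)) (f n n)) ⟩
  ∑² (suc n) f ∎
  where open ≤-Reasoning

-- Graphs as bit strings

T-∨⁻ : ∀ {a b} → T (a ∨ b) → T a ⊎ T b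
T-∨⁻ = Equivalence.to T-∨

T-∧⁺ : ∀ {a b} → T a → T b → T (a ∧ b)
T-∧⁺ {true} {true} _ _ = _

T-not⁻ : ∀ {b} → T (not b) → ¬ T b
T-not⁻ {false} _ ()

T-not⁺ : ∀ {b} → ¬ T b → T (not b)
T-not⁺ {true}  ¬t = contradiction _ ¬t
T-not⁺ {false} _  = _

vertexPairs-< : ∀ n {i j} → (i , j) ∈ vertexPairs n → i < j
vertexPairs-< n p∈ with j , j∈ , q ← find (∈-concatMap⁻ (λ j → map (λ i → (i , j)) (upTo j)) {xs = upTo n} p∈)
  with i , i∈ , refl ← ∈-map⁻ (λ i → (i , j)) q = ∈-upTo⁻ i∈

∈-zip⁻ˡ : ∀ {A B : Set} {x : A} {y : B} xs ys → (x , y) ∈ zip xs ys → x ∈ xs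
∈-zip⁻ˡ (x ∷ xs) (y ∷ ys) (here refl) = here refl
∈-zip⁻ˡ (x ∷ xs) (y ∷ ys) (there p)   = there (∈-zip⁻ˡ xs ys p)

∈-edgesOf⁻ : ∀ n G {p} → p ∈ edgesOf n G → (p , true) ∈ zip (vertexPairs n) G
∈-edgesOf⁻ n G p∈ with (_ , b) , q∈ , refl ← ∈-map⁻ proj₁ p∈
  with q∈zip , Tb ← ∈-filter⁻ (λ q → T? (proj₂ q)) {xs = zip (vertexPairs n) G} q∈ with true ← b = q∈zip

∈-edgesOf⁺ : ∀ n G {p} → (p , true) ∈ zip (vertexPairs n) G → p ∈ edgesOf n G
∈-edgesOf⁺ n G p∈ = ∈-map⁺ proj₁ (∈-filter⁺ (λ q → T? (proj₂ q)) p∈ _)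

adjacent⁻ : ∀ E x y → T (adjacent E x y) → (x , y) ∈ E ⊎ (y , x) ∈ E
adjacent⁻ E x y adj with (a , b) , e∈ , t ← find (any⁻ _ E adj) with T-∨⁻ {(a ≡ᵇ x) ∧ (b ≡ᵇ y)} t
... | inj₁ s with a≡ , b≡ ← T-∧⁻ {a ≡ᵇ x} s with refl ← ≡ᵇ⇒≡ a x a≡ | refl ← ≡ᵇ⇒≡ b y b≡ = inj₁ e∈
... | inj₂ s with a≡ , b≡ ← T-∧⁻ {a ≡ᵇ y} s with refl ← ≡ᵇ⇒≡ a y a≡ | refl ← ≡ᵇ⇒≡ b x b≡ = inj₂ e∈

adjacent⁺ : ∀ E x y → (x , y) ∈ E ⊎ (y , x) ∈ E → T (adjacent E x y)
adjacent⁺ E x y (inj₁ e∈) = any⁺ _ (lose e∈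
  (Equivalence.from T-∨ (inj₁ (T-∧⁺ (≡⇒≡ᵇ x x refl) (≡⇒≡ᵇ y y refl)))))
adjacent⁺ E x y (inj₂ e∈) = any⁺ _ (lose e∈
  (Equivalence.from (T-∨ {(y ≡ᵇ x) ∧ (x ≡ᵇ y)}) (inj₂ (T-∧⁺ (≡⇒≡ᵇ y y refl) (≡⇒≡ᵇ x x refl)))))

adjacent-sym : ∀ E x y → T (adjacent E x y) → T (adjacent E y x)
adjacent-sym E x y = adjacent⁺ E y x ∘ swap ∘ adjacent⁻ E x y

adjacent-≢ : ∀ n G {x y} → T (adjacent (edgesOf n G) x y) → x ≢ y
adjacent-≢ n G {x} {y} adj refl with adjacent⁻ (edgesOf n G) x y adj
... | inj₁ e∈ = <-irrefl refl (vertexPairs-< n (∈-zip⁻ˡ (vertexPairs n) G (∈-edgesOf⁻ n G e∈)))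
... | inj₂ e∈ = <-irrefl refl (vertexPairs-< n (∈-zip⁻ˡ (vertexPairs n) G (∈-edgesOf⁻ n G e∈)))

outside-≤ : ∀ {A : Set} (D g : A → Bool) vs bs → (∀ p → (p , true) ∈ zip vs bs → T (g p)) →
  outside (map D vs) bs ≤ count (λ p → g p ∧ not (D p)) vs
outside-≤ D g []       bs       h = z≤n
outside-≤ D g (v ∷ vs) []       h with D v
... | true  = z≤n
... | false = z≤n
outside-≤ D g (v ∷ vs) (b ∷ bs) h with D v
... | true  = ≤-trans (outside-≤ D g vs bs (λ p → h p ∘ there)) (m≤n+m _ _)
... | false = +-mono-≤ (first b (λ { refl → h v (here refl) })) (outside-≤ D g vs bs (λ p → h p ∘ there))
  where
  first : ∀ b → (b ≡ true → T (g v)) → b ▸ 1 ≤ (g v ∧ true) ▸ 1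
  first false _ = z≤n
  first true  t with g v | t refl
  ... | true | _ = ≤-refl

outside-zero : ∀ {A : Set} (D : A → Bool) vs bs → outside (map D vs) bs ≡ 0 →
  ∀ p → (p , true) ∈ zip vs bs → T (D p)
outside-zero D (v ∷ vs) (b ∷ bs) eq p p∈ with D v in Dv
outside-zero D (v ∷ vs) (b ∷ bs) eq p (here refl) | true = subst T (sym Dv) _
outside-zero D (v ∷ vs) (b ∷ bs) eq p (there p∈) | true = outside-zero D vs bs eq p p∈
outside-zero D (v ∷ vs) (false ∷ bs) eq p (there p∈) | false = outside-zero D vs bs eq p p∈

∑-head : ∀ n f → ∑ (suc n) f ≡ f 0 + ∑ n (f ∘ suc)
∑-head zero    f = sym (+-identityʳ (f 0))
∑-head (suc n) f = trans (cong (_+ f (suc n)) (∑-head n f)) (+-assoc (f 0) _ _)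

length-membersFrom : ∀ k p n → length (membersFrom k (bits p n)) ≡ ∑ n (λ i → p i ▸ 1)
length-membersFrom k p zero    = refl
length-membersFrom k p (suc n) = trans (head (p 0)) (trans (cong (p 0 ▸ 1 +_) (length-membersFrom (suc k) (p ∘ suc) n)) (sym (∑-head n (λ i → p i ▸ 1))))
  where
  head : ∀ b → length (membersFrom k (b ∷ bits (p ∘ suc) n)) ≡ b ▸ 1 + length (membersFrom (suc k) (bits (p ∘ suc) n))
  head true  = refl
  head false = refl

membersFrom-bits : ∀ {Q : ℕ → Set} k p n → (∀ i → T (p i) → Q (k + i)) → All Q (membersFrom k (bits p n))
membersFrom-bits k p zero    h = []
membersFrom-bits {Q} k p (suc n) h with p 0 in eq
... | true  = subst Q (+-identityʳ k) (h 0 (subst T (sym eq) _)) ∷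
  membersFrom-bits (suc k) (p ∘ suc) n (λ i t → subst Q (+-suc k i) (h (suc i) t))
... | false = membersFrom-bits (suc k) (p ∘ suc) n (λ i t → subst Q (+-suc k i) (h (suc i) t))

membersFrom-≥ : ∀ k bs → All (k ≤_) (membersFrom k bs)
membersFrom-≥ k []           = []
membersFrom-≥ k (true  ∷ bs) = ≤-refl ∷ All.map <⇒≤ (membersFrom-≥ (suc k) bs)
membersFrom-≥ k (false ∷ bs) = All.map <⇒≤ (membersFrom-≥ (suc k) bs)

membersFrom-sorted : ∀ k bs → AllPairs _<_ (membersFrom k bs)
membersFrom-sorted k []           = []
membersFrom-sorted k (true  ∷ bs) = membersFrom-≥ (suc k) bs ∷ membersFrom-sorted (suc k) bs
membersFrom-sorted k (false ∷ bs) = membersFrom-sorted (suc k) bs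

orderedPairs⁺ : ∀ {R : ℕ → ℕ → Set} {xs} → AllPairs R xs → All (uncurry R) (orderedPairs xs)
orderedPairs⁺ []       = []
orderedPairs⁺ (r ∷ rs) = All.++⁺ (All.map⁺ r) (orderedPairs⁺ rs)

orderedPairs⁻ : ∀ {R : ℕ → ℕ → Set} xs → All (uncurry R) (orderedPairs xs) → AllPairs R xs
orderedPairs⁻ []       _  = []
orderedPairs⁻ (x ∷ xs) rs = All.map⁻ (All.++⁻ˡ (map (x ,_) xs) rs) ∷ orderedPairs⁻ xs (All.++⁻ʳ (map (x ,_) xs) rs)

AllPairs-lookup : ∀ {R : ℕ → ℕ → Set} {xs} → AllPairs R xs → ∀ {i j} → i Fin.< j → R (lookup xs i) (lookup xs j)
AllPairs-lookup (r ∷ rs) {zero}  {suc j} _         = All.lookup r (∈-lookup j)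
AllPairs-lookup (r ∷ rs) {suc i} {suc j} (s≤s i<j) = AllPairs-lookup rs i<j

AllPairs-strengthen : ∀ {P : ℕ → Set} {R S : ℕ → ℕ → Set} →
  (∀ {x y} → P x → P y → R x y → S x y) → ∀ {xs} → All P xs → AllPairs R xs → AllPairs S xs
AllPairs-strengthen f []       []       = []
AllPairs-strengthen f (p ∷ ps) (r ∷ rs) =
  All.zipWith (λ { (py , rxy) → f p py rxy }) (ps , r) ∷ AllPairs-strengthen f ps rs

-- From clique tuples to vertex sets.

elem : ∀ {s} → ℕ → Vec ℕ s → Bool
elem y []      = false
elem y (u ∷ x) = (y ≡ᵇ u) ∨ elem y x

elem⇒lookup : ∀ {s} y (x : Vec ℕ s) → T (elem y x) → ∃ λ i → Vec.lookup x i ≡ y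
elem⇒lookup y (u ∷ x) t with T-∨⁻ {y ≡ᵇ u} t
... | inj₁ eq = zero , sym (≡ᵇ⇒≡ y u eq)
... | inj₂ t′ with i , eq ← elem⇒lookup y x t′ = suc i , eq

module TupleClique (n : ℕ) (g : ℕ → ℕ → Bool)
  (g-sym : ∀ x y → T (g x y) → T (g y x)) (g-irr : ∀ {x y} → T (g x y) → x ≢ y) where

  IsClique : ∀ {s} → Vec ℕ s → Set
  IsClique {s} x = T (sat g (pairs s) x)

  clique-∷ : ∀ {s} u (x : Vec ℕ s) → IsClique (u ∷ x) → (∀ i → T (g u (Vec.lookup x i))) × IsClique x
  clique-∷ u x cl with t , cl′ ← T-∧⁻ {allᶠ (λ i → g u (Vec.lookup x i))} (subst T (sat-pairs g u x) cl) =
    allᶠ-T t , cl′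

  -- Irreflexivity of `g` makes the entries of a clique tuple distinct. This bridges the tuples used
  -- for counting and the vertex sets of exact size that `containsClique` asks for.
  clique-card : ∀ {s} (x : Vec ℕ s) → IsClique x → (∀ i → Vec.lookup x i < n) →
    ∑ n (λ y → elem y x ▸ 1) ≡ s
  clique-card []      cl x<n = ∑-zero n
  clique-card {suc s} (u ∷ x) cl x<n with adj , cl′ ← clique-∷ u x cl = begin
    ∑ n (λ y → ((y ≡ᵇ u) ∨ elem y x) ▸ 1)
      ≡⟨ ∑-cong n (λ y _ → pt (y ≡ᵇ u) (elem y x) (disjoint y)) ⟩
    ∑ n (λ y → (y ≡ᵇ u) ▸ 1 + elem y x ▸ 1)
      ≡⟨ ∑-+ n _ _ ⟩
    ∑ n (λ y → (y ≡ᵇ u) ▸ 1) + ∑ n (λ y → elem y x ▸ 1)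
      ≡⟨ cong₂ _+_ (∑-indicator n u (λ _ → 1) (x<n zero)) (clique-card x cl′ (x<n ∘ suc)) ⟩
    suc s ∎
    where
    open ≡-Reasoning
    pt : ∀ a b → ¬ (T a × T b) → (a ∨ b) ▸ 1 ≡ a ▸ 1 + b ▸ 1
    pt false b     _  = refl
    pt true  false _  = refl
    pt true  true  ab = contradiction _ ab
    disjoint : ∀ y → ¬ (T (y ≡ᵇ u) × T (elem y x))
    disjoint y (y≡u , y∈x) with i , xi≡y ← elem⇒lookup y x y∈x =
      g-irr (adj i) (trans (sym (≡ᵇ⇒≡ y u y≡u)) (sym xi≡y))

  clique-adjacent : ∀ {s} (x : Vec ℕ s) → IsClique x → ∀ {y z} →
    T (elem y x) → T (elem z x) → y ≢ z → T (g y z)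
  clique-adjacent (u ∷ x) cl {y} {z} y∈ z∈ y≢z with adj , cl′ ← clique-∷ u x cl
    with T-∨⁻ {y ≡ᵇ u} y∈ | T-∨⁻ {z ≡ᵇ u} z∈
  ... | inj₁ y≡ | inj₁ z≡ = contradiction (trans (≡ᵇ⇒≡ y u y≡) (sym (≡ᵇ⇒≡ z u z≡))) y≢z
  ... | inj₂ y∈x | inj₂ z∈x = clique-adjacent x cl′ y∈x z∈x y≢z
  ... | inj₁ y≡ | inj₂ z∈x with refl ← ≡ᵇ⇒≡ y u y≡ | i , refl ← elem⇒lookup z x z∈x = adj i
  ... | inj₂ y∈x | inj₁ z≡ with refl ← ≡ᵇ⇒≡ z u z≡ | i , refl ← elem⇒lookup y x y∈x = g-sym _ _ (adj i)

clique⇒containsClique : ∀ n G {s} (x : Vec ℕ s) → (∀ i → Vec.lookup x i < n) →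
  T (sat (adjacent (edgesOf n G)) (pairs s) x) → T (containsClique s n G)
clique⇒containsClique n G {s} x x<n cl = any⁺ _ (lose (bits∈bitstrings (λ y → elem y x) n)
  (T-∧⁺ (≡⇒≡ᵇ _ s (trans (length-membersFrom 0 (λ y → elem y x) n) (clique-card x cl x<n)))
        (All.all⁻ _ (orderedPairs⁺ (AllPairs-strengthen
          (λ y∈ z∈ y<z → clique-adjacent x cl y∈ z∈ (<⇒≢ y<z))
          (membersFrom-bits 0 (λ y → elem y x) n (λ _ t → t))
          (membersFrom-sorted 0 (bits (λ y → elem y x) n)))))))
  where
  open TupleClique n (adjacent (edgesOf n G)) (adjacent-sym (edgesOf n G)) (adjacent-≢ n G)

-- Turán graphs

sameClass : ∀ r .{{_ : NonZero r}} → ℕ → ℕ → Bool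
sameClass r x y = x % r ≡ᵇ y % r

∑-split : ∀ m n f → ∑ (m + n) f ≡ ∑ m f + ∑ n (λ i → f (m + i))
∑-split m zero    f = trans (cong (λ k → ∑ k f) (+-identityʳ m)) (sym (+-identityʳ (∑ m f)))
∑-split m (suc n) f = trans (cong (λ k → ∑ k f) (+-suc m n))
  (trans (cong (_+ f (m + n)) (∑-split m n f)) (+-assoc (∑ m f) _ _))

-- Each of the `q` full blocks contains the residue `a` once, and the incomplete block stops just
-- before it. A range ending at `q * r + a` is what a vertex sees when it counts earlier members of
-- its own class.
class-size : ∀ r .{{_ : NonZero r}} a q → a < r → ∑ (q * r + a) (λ i → (i % r ≡ᵇ a) ▸ 1) ≡ q
class-size r a zero    a<r = trans (∑-cong a none) (∑-zero a)
  where
  none : ∀ i → i < a → (i % r ≡ᵇ a) ▸ 1 ≡ 0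
  none i i<a with i % r ≡ᵇ a in eq
  ... | false = refl
  ... | true  = contradiction
    (trans (sym (m<n⇒m%n≡m (<-trans i<a a<r))) (≡ᵇ⇒≡ (i % r) a (subst T (sym eq) _))) (<⇒≢ i<a)
class-size r a (suc q) a<r = begin
  ∑ (r + q * r + a) f                        ≡⟨ cong (λ k → ∑ k f) (+-assoc r (q * r) a) ⟩
  ∑ (r + (q * r + a)) f                      ≡⟨ ∑-split r (q * r + a) f ⟩
  ∑ r f + ∑ (q * r + a) (λ i → f (r + i))
    ≡⟨ cong₂ _+_ first (∑-cong (q * r + a) λ i _ → cong (λ k → (k ≡ᵇ a) ▸ 1)
         (trans (cong (_% r) (+-comm r i)) ([m+n]%n≡m%n i r))) ⟩
  1 + ∑ (q * r + a) f                        ≡⟨ cong suc (class-size r a q a<r) ⟩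
  suc q                                      ∎
  where
  open ≡-Reasoning
  f : ℕ → ℕ
  f i = (i % r ≡ᵇ a) ▸ 1
  first : ∑ r f ≡ 1
  first = trans (∑-cong r λ i i<r → cong (λ k → (k ≡ᵇ a) ▸ 1) (m<n⇒m%n≡m i<r))
    (∑-indicator r a (λ _ → 1) a<r)

turánMask : ∀ r .{{_ : NonZero r}} → ℕ → List Bool
turánMask r n = map (λ p → not (sameClass r (proj₁ p) (proj₂ p))) (vertexPairs n)

triangular : ∀ n → 2 * ∑ n (λ j → j) ≡ n * (n ∸ 1)
triangular zero          = refl
triangular (suc zero)    = refl
triangular (suc (suc n)) = trans (*-distribˡ-+ 2 (∑ (suc n) (λ j → j)) (suc n))
  (trans (cong (_+ 2 * suc n) (triangular (suc n))) (eq n))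
  where
  eq : ∀ n → suc n * n + 2 * suc n ≡ suc (suc n) * suc n
  eq = solve-∀

-- Vertex `j` has exactly ⌊j/(r+1)⌋ earlier vertices in its residue class, hence at least j r/(r+1)
-- earlier neighbours. Summing over `j` gives the Turán density times n(n-1)/2 with no error term.
turán-edges : ∀ r n → r * (n * (n ∸ 1)) ≤ 2 * (suc r * ones (turánMask (suc r) n))
turán-edges r n = begin
  r * (n * (n ∸ 1))                                   ≡⟨ cong (r *_) (triangular n) ⟨
  r * (2 * ∑ n (λ j → j))                             ≡⟨ eq₁ r (∑ n (λ j → j)) ⟩
  2 * (r * ∑ n (λ j → j))                             ≡⟨ cong (2 *_) (∑-* n r _) ⟨
  2 * ∑ n (λ j → r * j)                               ≤⟨ *-monoʳ-≤ 2 (∑-mono n λ j _ → row j) ⟩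
  2 * ∑ n (λ j → suc r * ∑ j (λ i → not (sameClass (suc r) i j) ▸ 1))
    ≡⟨ cong (2 *_) (∑-* n (suc r) _) ⟩
  2 * (suc r * ∑ n (λ j → ∑ j (λ i → not (sameClass (suc r) i j) ▸ 1)))
    ≡⟨ cong (λ e → 2 * (suc r * e)) (trans (∑ᴸ-map (_▸ 1) _ (vertexPairs n)) (∑ᴸ-vertexPairs _ n)) ⟨
  2 * (suc r * ones (turánMask (suc r) n))            ∎
  where
  open ≤-Reasoning
  eq₁ : ∀ r s → r * (2 * s) ≡ 2 * (r * s)
  eq₁ = solve-∀
  row : ∀ j → r * j ≤ suc r * ∑ j (λ i → not (sameClass (suc r) i j) ▸ 1)
  row j = +-cancelˡ-≤ j _ _ (begin
    suc r * j                     ≡⟨ cong (suc r *_) both ⟨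
    suc r * (same + diff)         ≡⟨ *-distribˡ-+ (suc r) same diff ⟩
    suc r * same + suc r * diff   ≤⟨ +-monoˡ-≤ (suc r * diff) same≤ ⟩
    j + suc r * diff              ∎)
    where
    same = ∑ j (λ i → sameClass (suc r) i j ▸ 1)
    diff = ∑ j (λ i → not (sameClass (suc r) i j) ▸ 1)
    pt : ∀ b → b ▸ 1 + not b ▸ 1 ≡ 1
    pt true  = refl
    pt false = refl
    both : same + diff ≡ j
    both = trans (sym (∑-+ j _ _)) (trans (∑-cong j λ i _ → pt (sameClass (suc r) i j))
      (trans (∑-const j 1) (*-identityʳ j)))
    j≡ : j ≡ j / suc r * suc r + j % suc r
    j≡ = trans (m≡m%n+[m/n]*n j (suc r)) (+-comm (j % suc r) _)
    same≡ : same ≡ j / suc r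
    same≡ = trans (cong (λ k → ∑ k (λ i → sameClass (suc r) i j ▸ 1)) j≡)
      (class-size (suc r) (j % suc r) (j / suc r) (m%n<n j (suc r)))
    same≤ : suc r * same ≤ j
    same≤ = begin
      suc r * same                          ≡⟨ cong (suc r *_) same≡ ⟩
      suc r * (j / suc r)                   ≡⟨ *-comm (suc r) (j / suc r) ⟩
      j / suc r * suc r                     ≤⟨ m≤m+n _ (j % suc r) ⟩
      j / suc r * suc r + j % suc r         ≡⟨ j≡ ⟨
      j                                     ∎

turán-cliqueFree : ∀ r .{{_ : NonZero r}} n G → outside (turánMask r n) G ≡ 0 →
  ¬ T (containsClique (suc r) n G)
turán-cliqueFree r n G out cl
  with S , _ , t ← find (any⁻ _ (bitstrings n) cl)
  with len , adj ← T-∧⁻ {length (membersFrom 0 S) ≡ᵇ suc r} t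
  -- Two of the `suc r` clique vertices must share one of the `r` residues.
  with i , j , i<j , same ← Fin.pigeonhole
         (subst (r <_) (sym (≡ᵇ⇒≡ (length (membersFrom 0 S)) (suc r) len)) ≤-refl)
         (λ i → lookup (membersFrom 0 S) i mod r) =
  multipartite (AllPairs-lookup (orderedPairs⁻ (membersFrom 0 S) (All.all⁺ _ _ adj)) i<j) (begin
    lookup (membersFrom 0 S) i % r            ≡⟨ Fin.toℕ-fromℕ< _ ⟨
    toℕ (lookup (membersFrom 0 S) i mod r)    ≡⟨ cong toℕ same ⟩
    toℕ (lookup (membersFrom 0 S) j mod r)    ≡⟨ Fin.toℕ-fromℕ< _ ⟩
    lookup (membersFrom 0 S) j % r            ∎)
  where
  open ≡-Reasoning
  edge : ∀ {x y} → (x , y) ∈ edgesOf n G → x % r ≢ y % r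
  edge {x} {y} e∈ eq =
    T-not⁻ (outside-zero (λ p → not (sameClass r (proj₁ p) (proj₂ p))) (vertexPairs n) G out (x , y) (∈-edgesOf⁻ n G e∈))
          (≡⇒≡ᵇ (x % r) (y % r) eq)
  multipartite : ∀ {x y} → T (adjacent (edgesOf n G) x y) → x % r ≢ y % r
  multipartite {x} {y} adj with adjacent⁻ (edgesOf n G) x y adj
  ... | inj₁ e∈ = edge e∈
  ... | inj₂ e∈ = edge e∈ ∘ sym

numCliqueFree-≥ : ∀ r .{{_ : NonZero r}} n → 2 ^ ones (turánMask r n) ≤ numCliqueFree n (suc r)
numCliqueFree-≥ r n = begin
  2 ^ ones (turánMask r n)        ≤⟨ strings-≥ (turánMask r n) ⟩
  strings (turánMask r n) 1       ≡⟨ cong (λ k → count (λ G → outside (turánMask r n) G <ᵇ 1) (bitstrings k)) (length-map _ (vertexPairs n)) ⟩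
  count (λ G → outside (turánMask r n) G <ᵇ 1) (labeledGraphs n)
    ≤⟨ count-mono-∈ (labeledGraphs n) (λ G _ t → T-not⁺ (turán-cliqueFree r n G (n<1⇒n≡0 (<ᵇ⇒< _ 1 t)))) ⟩
  count (λ G → not (containsClique (suc r) n G)) (labeledGraphs n)
    ≡⟨ length-filterᵇ _ (labeledGraphs n) ⟨
  numCliqueFree n (suc r)         ∎
  where
  open ≤-Reasoning

-- Containers

m*n≤o⇒m≤o/n : ∀ m n o .{{_ : NonZero n}} → m * n ≤ o → m ≤ o / n
m*n≤o⇒m≤o/n m n o mn≤o = ≤-trans (≤-reflexive (sym (m*n/n≡m m n))) (/-monoˡ-≤ n mn≤o)

pairs-ordered : ∀ s → All Ordered (pairs s)
pairs-ordered zero    = []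
pairs-ordered (suc s) = All.++⁺ (All.tabulate⁺ λ _ → s≤s z≤n) (All.map⁺ (All.map s≤s (pairs-ordered s)))

pairs-distinct : ∀ s → AllPairs _≢_ (pairs s)
pairs-distinct zero    = []
pairs-distinct (suc s) = AllPairs.++⁺
  (AllPairs.tabulate⁺ λ i≢j eq → i≢j (Fin.suc-injective (cong proj₂ eq)))
  (AllPairs.map⁺ (AllPairs.map (λ p≢q eq → p≢q (cong₂ _,_ (Fin.suc-injective (cong proj₁ eq)) (Fin.suc-injective (cong proj₂ eq))))
    (pairs-distinct s)))
  (All.tabulate⁺ λ i → All.map⁺ (All.universal (λ _ ()) (pairs s)))

length-pairs : ∀ s → length (pairs s) ≤ s * s
length-pairs zero    = z≤n
length-pairs (suc s) = begin
  length (tabulate (λ (i : Fin s) → zero {s} , suc i) ++ map shift (pairs s))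
    ≡⟨ trans (length-++ (tabulate (λ (i : Fin s) → zero {s} , suc i)))
         (cong₂ _+_ (length-tabulate {n = s} _) (length-map shift (pairs s))) ⟩
  s + length (pairs s)     ≤⟨ +-monoʳ-≤ s (length-pairs s) ⟩
  s + s * s                ≤⟨ +-mono-≤ (n≤1+n s) (*-monoʳ-≤ s (n≤1+n s)) ⟩
  suc s * suc s            ∎
  where open ≤-Reasoning

sat-ʳ++ : ∀ R {s} Q {P : List (Pair s)} x → T (sat R (Q ʳ++ P) x) → T (sat R Q x) × T (sat R P x)
sat-ʳ++ R []            x t = _ , t
sat-ʳ++ R ((a , b) ∷ Q) x t with tQ , tP ← sat-ʳ++ R Q x t
  with te , tP′ ← T-∧⁻ {R (Vec.lookup x a) (Vec.lookup x b)} tP = T-∧⁺ te tQ , tP′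

∑ᵛ-zero : ∀ n s {F} → (∀ x → (∀ i → Vec.lookup x i < n) → F x ≡ 0) → ∑ᵛ n s F ≡ 0
∑ᵛ-zero n zero    F≡0 = F≡0 [] λ ()
∑ᵛ-zero n (suc s) F≡0 = trans
  (∑-cong n λ u u<n → ∑ᵛ-zero n s λ x x<n → F≡0 (u ∷ x) λ { zero → u<n ; (suc i) → x<n i })
  (∑-zero n)

-- `θ-large` says that the total error of the exchanges is too small to support a dense set of more
-- than `t` vertices. `w-large` makes the weight 2^(q+1) in the count of strings cost at most `w`
-- bits over all pairs. `E` will bound the edges of a container, and `m` the edges of a graph
-- outside its container.
module Container (n r h′ θ H t q w : ℕ)
  .{{_ : NonZero n}} .{{_ : NonZero r}} .{{_ : NonZero θ}} .{{_ : NonZero H}}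
  (θ-large : suc h′ ^ suc r * (length (pairs (suc r)) * H ^ length (pairs (suc r)) * n ^ suc r) < θ * suc t ^ suc r)
  (w-large : n * n ≤ 2 ^ q * w) where

  ℓ M h m 2rh E : ℕ
  ℓ = suc r
  M = θ * H
  h = suc h′
  m = n * n / H
  2rh = 2 * (r * h)

  instance
    2rh≢0 : NonZero 2rh
    2rh≢0 = m*n≢0 2 (r * h) {{it}} {{m*n≢0 r h}}

  E = ((r * h ∸ h′) * (n * suc n) + r * h * (t * t)) / 2rh

  weight : List Step → Weight
  weight c = Run.run θ c (λ _ _ → 0)

  -- Lowering on A × B can destroy the symmetry of the weight, so both orientations are required to
  -- be heavy. An edge of G outside D is then light in at least one orientation, and `light` sums
  -- over both.
  D : List Step → ℕ → ℕ → Bool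
  D c x y = (θ ≤ᵇ weight c x y) ∧ (θ ≤ᵇ weight c y x)

  mask : List Step → List Bool
  mask c = map (λ p → D c (proj₁ p) (proj₂ p)) (vertexPairs n)

  length-mask : ∀ c → length (mask c) ≡ length (vertexPairs n)
  length-mask c = length-map _ (vertexPairs n)

  D-sym : ∀ c x y → D c x y ≡ D c y x
  D-sym c x y = ∧-comm (θ ≤ᵇ weight c x y) (θ ≤ᵇ weight c y x)

  zeros-mask : ∀ c → zeros (mask c) ≤ 2 ^ q * w
  zeros-mask c = begin
    zeros (mask c)                          ≡⟨ trans (∑ᴸ-map _ _ (vertexPairs n)) (∑ᴸ-vertexPairs _ n) ⟩
    ∑ n (λ j → ∑ j λ i → not (D c i j) ▸ 1) ≤⟨ ∑-mono n (λ j _ → ∑-mono j λ i _ → ≤-trans (▸-≤ (not (D c i j)) 1) (m≤m+n 1 1)) ⟩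
    ∑ n (λ j → ∑ j λ i → 1 + 1)             ≤⟨ ∑-triangle n (λ _ _ → 1) ⟩
    ∑² n (λ _ _ → 1)                        ≡⟨ trans (∑²-const n 1) (*-identityʳ (n * n)) ⟩
    n * n                                   ≤⟨ w-large ⟩
    2 ^ q * w                               ∎
    where open ≤-Reasoning

  K : ℕ
  K = 2 ^ (E + (suc q * m + w))

  -- A code need not come from a K_ℓ-free graph, and its mask may then be large. The test on `ones`
  -- lets such a code capture nothing, so that the bound `K` is uniform in the code.
  captures : List Step → List Bool → Bool
  captures c G = (ones (mask c) ≤ᵇ E) ∧ (outside (mask c) G <ᵇ suc m)

  captures-few : ∀ c → count (captures c) (labeledGraphs n) ≤ K
  captures-few c with ones (mask c) ≤ᵇ E in eq
  ... | false = ≤-trans (≤-reflexive (∑ᴸ-zero (labeledGraphs n))) z≤n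
  ... | true  = begin
    count (λ G → outside (mask c) G <ᵇ suc m) (labeledGraphs n)
      ≡⟨ cong (λ k → count (λ G → outside (mask c) G <ᵇ suc m) (bitstrings k)) (length-mask c) ⟨
    strings (mask c) (suc m)                   ≤⟨ strings-bound q (mask c) m w (zeros-mask c) ⟩
    2 ^ (ones (mask c) + (suc q * m + w))      ≤⟨ ^-monoʳ-≤ 2 (+-monoˡ-≤ _ (≤ᵇ⇒≤ (ones (mask c)) E (subst T (sym eq) _))) ⟩
    K                                          ∎
    where open ≤-Reasoning

  module _ (G : List Bool) (free : ¬ T (containsClique ℓ n G)) where

    g : ℕ → ℕ → Bool
    g = adjacent (edgesOf n G)

    open Regularise n θ H g using (Regular; light; regular-code)

    module _ (c : List Step) (reg : Regular (weight c)) where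

      open Regular reg

      W : Weight
      W = weight c

      D≤g : ∀ A B → θ * rect n A B (bit▸ (D c)) ≤ θ * H * rect n A B (bit▸ g) + n * n
      D≤g A B = begin
        θ * rect n A B (bit▸ (D c))                            ≡⟨ ∑²-* n θ _ ⟨
        ∑² n (λ x y → θ * ((A x ∧ B y) ▸ D c x y ▸ 1))         ≤⟨ ∑²-mono n (λ x y → pt (A x ∧ B y) x y) ⟩
        rect n A B W                                           ≤⟨ thin A B ⟩
        θ * H * rect n A B (bit▸ g) + n * n                    ∎
        where
        open ≤-Reasoning
        pt : ∀ k x y → θ * (k ▸ D c x y ▸ 1) ≤ k ▸ W x y
        pt false x y = ≤-reflexive (*-zeroʳ θ)
        pt true  x y with D c x y in eq
        ... | false = ≤-trans (≤-reflexive (*-zeroʳ θ)) z≤n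
        ... | true  = ≤-trans (≤-reflexive (*-identityʳ θ))
          (≤ᵇ⇒≤ θ (W x y) (proj₁ (T-∧⁻ {θ ≤ᵇ W x y} (subst T (sym eq) _))))

      open Hybrid n ℓ θ H (D c) g D≤g
      open Peel n r h′ (D c) (D-sym c) using (cliques; total-edges-bound)

      no-cliques : N (pairs ℓ ʳ++ []) [] ≡ 0
      no-cliques = ∑ᵛ-zero n ℓ λ x x<n → none (sat g (pairs ℓ ʳ++ []) x)
        λ t → free (clique⇒containsClique n G x x<n (proj₁ (sat-ʳ++ g (pairs ℓ) x t)))
        where
        none : ∀ b → ¬ T b → (b ∧ true) ▸ 1 ≡ 0
        none false _  = refl
        none true  ¬t = contradiction _ ¬t

      -- Exchanging all pairs ends at the count of K_ℓ in G, which vanishes; what remains is the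
      -- accumulated additive error.
      few-cliques : h ^ ℓ * cliques ℓ < suc t ^ ℓ
      few-cliques = *-cancelˡ-< θ _ _ (begin-strict
        θ * (h ^ ℓ * cliques ℓ)        ≡⟨ eq θ (h ^ ℓ) (cliques ℓ) ⟩
        h ^ ℓ * (θ * N [] (pairs ℓ))
          ≤⟨ *-monoʳ-≤ (h ^ ℓ) (exchange-all (pairs ℓ) [] (pairs-ordered ℓ) (pairs-distinct ℓ) (All.universal (λ _ → []) (pairs ℓ))) ⟩
        h ^ ℓ * (θ * H ^ κ * N (pairs ℓ ʳ++ []) [] + κ * H ^ κ * n ^ ℓ)
          ≡⟨ cong (λ z → h ^ ℓ * (z + κ * H ^ κ * n ^ ℓ)) (trans (cong (θ * H ^ κ *_) no-cliques) (*-zeroʳ (θ * H ^ κ))) ⟩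
        h ^ ℓ * (κ * H ^ κ * n ^ ℓ)    <⟨ θ-large ⟩
        θ * suc t ^ ℓ                  ∎)
        where
        open ≤-Reasoning
        κ = length (pairs ℓ)
        eq : ∀ a b c → a * (b * c) ≡ b * (a * c)
        eq = solve-∀

      ones-mask : ones (mask c) ≤ E
      ones-mask = m*n≤o⇒m≤o/n (ones (mask c)) 2rh _ (begin
        ones (mask c) * 2rh            ≡⟨ eq (ones (mask c)) (r * h) ⟩
        r * h * (2 * ones (mask c))    ≤⟨ *-monoʳ-≤ (r * h) twice ⟩
        r * h * ∑² n (bit▸ (D c))      ≤⟨ total-edges-bound t few-cliques ⟩
        (r * h ∸ h′) * (n * suc n) + r * h * (t * t) ∎)
        where
        open ≤-Reasoning
        eq : ∀ a b → a * (2 * b) ≡ b * (2 * a)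
        eq = solve-∀
        eq₂ : ∀ a → 2 * a ≡ a + a
        eq₂ = solve-∀
        row : ℕ → ℕ
        row j = ∑ j λ i → D c i j ▸ 1
        twice : 2 * ones (mask c) ≤ ∑² n (bit▸ (D c))
        twice = begin
          2 * ones (mask c)                              ≡⟨ cong (2 *_) (trans (∑ᴸ-map _ _ (vertexPairs n)) (∑ᴸ-vertexPairs _ n)) ⟩
          2 * ∑ n (λ j → ∑ j λ i → D c i j ▸ 1)          ≡⟨ trans (eq₂ (∑ n row)) (sym (∑-+ n row row)) ⟩
          ∑ n (λ j → ∑ j (λ i → D c i j ▸ 1) + ∑ j (λ i → D c i j ▸ 1))
            ≡⟨ ∑-cong n (λ j _ → trans (sym (∑-+ j _ _)) (∑-cong j λ i _ → cong (λ b → D c i j ▸ 1 + b ▸ 1) (D-sym c i j))) ⟩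
          ∑ n (λ j → ∑ j λ i → D c i j ▸ 1 + D c j i ▸ 1) ≤⟨ ∑-triangle n (bit▸ (D c)) ⟩
          ∑² n (bit▸ (D c))                              ∎

      outside-mask : outside (mask c) G ≤ m
      outside-mask = m*n≤o⇒m≤o/n (outside (mask c) G) H _ (begin
        outside (mask c) G * H      ≡⟨ *-comm _ H ⟩
        H * outside (mask c) G      ≤⟨ *-monoʳ-≤ H below ⟩
        H * light W                 ≤⟨ few-light ⟩
        n * n                       ∎)
        where
        open ≤-Reasoning
        f : ℕ → ℕ → ℕ
        f x y = (W x y <ᵇ θ) ▸ bit▸ g x y
        ≤ᵇ∨<ᵇ : ∀ a b → T (not (a ≤ᵇ b)) → (b <ᵇ a) ≡ true
        ≤ᵇ∨<ᵇ a b nt with b <ᵇ a in eq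
        ... | true  = refl
        ... | false with a ≤ᵇ b | ≤⇒≤ᵇ {a} {b} (≮⇒≥ λ b<a → subst T eq (<⇒<ᵇ b<a))
        ...   | true | _ = contradiction nt λ ()
        pt : ∀ i j → (g i j ∧ not (D c i j)) ▸ 1 ≤ f i j + f j i
        pt i j with g i j in gij
        ... | false = z≤n
        ... | true with g j i | adjacent-sym (edgesOf n G) i j (subst T (sym gij) _)
        ...   | true | _ with θ ≤ᵇ W i j in a | θ ≤ᵇ W j i in b
        ...     | true  | true  = z≤n
        ...     | false | _ = ≤-trans (≤-reflexive (sym (cong (_▸ 1) (≤ᵇ∨<ᵇ θ (W i j) (subst (T ∘ not) (sym a) _))))) (m≤m+n _ _)
        ...     | true  | false = ≤-trans (≤-reflexive (sym (cong (_▸ 1) (≤ᵇ∨<ᵇ θ (W j i) (subst (T ∘ not) (sym b) _))))) (m≤n+m _ _)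
        below : outside (mask c) G ≤ light W
        below = begin
          outside (mask c) G
            ≤⟨ outside-≤ _ (λ p → g (proj₁ p) (proj₂ p)) (vertexPairs n) G
                 (λ p p∈ → adjacent⁺ (edgesOf n G) (proj₁ p) (proj₂ p) (inj₁ (∈-edgesOf⁺ n G p∈))) ⟩
          count (λ p → g (proj₁ p) (proj₂ p) ∧ not (D c (proj₁ p) (proj₂ p))) (vertexPairs n)
            ≡⟨ ∑ᴸ-vertexPairs _ n ⟩
          ∑ n (λ j → ∑ j λ i → (g i j ∧ not (D c i j)) ▸ 1)
            ≤⟨ ∑-mono n (λ j _ → ∑-mono j λ i _ → pt i j) ⟩
          ∑ n (λ j → ∑ j λ i → f i j + f j i)
            ≤⟨ ∑-triangle n f ⟩
          light W ∎

    captured : ∃ λ c → c ∈ codes n (M * M) × T (captures c G)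
    captured with c , c∈ , reg ← regular-code =
      c , c∈ , T-∧⁺ (≤⇒≤ᵇ (ones-mask c reg)) (<⇒<ᵇ (s≤s (outside-mask c reg)))

  numCliqueFree-≤ : numCliqueFree n ℓ ≤ 2 ^ (suc (n + n) * (M * M) + (E + (suc q * m + w)))
  numCliqueFree-≤ = begin
    numCliqueFree n ℓ                       ≡⟨ length-filterᵇ _ (labeledGraphs n) ⟩
    count (λ G → not (containsClique ℓ n G)) (labeledGraphs n)
      ≤⟨ count-cover captures K (labeledGraphs n) captures-few (codes n (M * M)) _ (λ G _ t → captured G (T-not⁻ t)) ⟩
    length (codes n (M * M)) * K            ≤⟨ *-monoˡ-≤ K (length-codes n (M * M)) ⟩
    2 ^ (suc (n + n) * (M * M)) * K         ≡⟨ ^-distribˡ-+-* 2 (suc (n + n) * (M * M)) _ ⟨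
    2 ^ (suc (n + n) * (M * M) + (E + (suc q * m + w))) ∎
    where
    open ≤-Reasoning

-- Choice of parameters

n≤2^n : ∀ n → n ≤ 2 ^ n
n≤2^n zero    = z≤n
n≤2^n (suc n) = ≤-trans (+-mono-≤ (m^n>0 2 n) (n≤2^n n)) (≤-reflexive (eq (2 ^ n)))
  where
  eq : ∀ p → p + p ≡ 2 * p
  eq = solve-∀

square-cancel-≤ : ∀ {a b} → a * a ≤ b * b → a ≤ b
square-cancel-≤ aa≤bb = ≮⇒≥ λ b<a → <⇒≱ (*-mono-< b<a b<a) aa≤bb

n<d*suc[n/d] : ∀ n d .{{_ : NonZero d}} → n < d * suc (n / d)
n<d*suc[n/d] n d = begin-strict
  n                    ≡⟨ m≡m%n+[m/n]*n n d ⟩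
  n % d + n / d * d    <⟨ +-monoˡ-< (n / d * d) (m%n<n n d) ⟩
  d + n / d * d        ≡⟨ *-comm (suc (n / d)) d ⟩
  d * suc (n / d)      ∎
  where open ≤-Reasoning

d*[n/d]≤n : ∀ n d .{{_ : NonZero d}} → d * (n / d) ≤ n
d*[n/d]≤n n d = ≤-trans (≤-reflexive (*-comm d (n / d))) (m/n*n≤m n d)

^≤expPartial : ∀ k m → k ^ m ≤ expPartial k m
^≤expPartial k zero    = ≤-refl
^≤expPartial k (suc m) = m≤n+m (k ^ suc m) (suc m * expPartial k m)

j!≤m^j : ∀ m j → j ≤ m → j ! ≤ m ^ j
j!≤m^j m zero    _   = ≤-refl
j!≤m^j m (suc j) j<m = *-mono-≤ j<m (j!≤m^j m j (<⇒≤ j<m))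

-- The single term (2m)^m / m! ≥ 2^m of the exponential series suffices.
ExpLe⇒2^m≤n : ∀ m n → ExpLe (2 * m) n → 2 ^ m ≤ n
ExpLe⇒2^m≤n zero      n e^2m≤n = ≤-trans (e^2m≤n 0) (≤-reflexive (*-identityʳ n))
ExpLe⇒2^m≤n m@(suc _) n e^2m≤n = *-cancelʳ-≤ (2 ^ m) n (m ^ m) {{m^n≢0 m m}} (begin
  2 ^ m * m ^ m         ≡⟨ ^-distribʳ-* m 2 m ⟨
  (2 * m) ^ m           ≤⟨ ^≤expPartial (2 * m) m ⟩
  expPartial (2 * m) m  ≤⟨ e^2m≤n m ⟩
  n * m !               ≤⟨ *-monoʳ-≤ n (j!≤m^j m m ≤-refl) ⟩
  n * m ^ m             ∎)
  where open ≤-Reasoning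

-- Multiplied by 4h, each of the six error terms is at most h r n², against the available 8 h r n².
exponent-bound : ∀ r′ k′ n₀ P E t Y₁ Y₂ Y₃ .{{_ : NonZero k′}} →
  let r = suc r′ ; ℓ = suc r ; h = 8 * k′ ; n = suc n₀ in
  P ≡ ℓ * k′ →
  2 * (r * h) * E ≤ (r′ * h + 1) * (n * suc n) + r * h * (t * t) →
  2 * P * t ≤ n → 8 * P ≤ n →
  8 * P * Y₁ ≤ n * n → 8 * P * Y₂ ≤ n * n → 8 * P * Y₃ ≤ n * n →
  2 * r * ℓ * k′ * (Y₁ + (E + (Y₂ + Y₃))) ≤ r′ * (n * n₀) * ℓ * k′ + 2 * r * (n * n)
exponent-bound r′ k′ n₀ P E t Y₁ Y₂ Y₃ refl E≤ t≤ n≥ Y₁≤ Y₂≤ Y₃≤ =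
  *-cancelˡ-≤ (4 * h) {{m*n≢0 4 h {{it}} {{m*n≢0 8 k′}}}} (begin
    4 * h * (2 * r * ℓ * k′ * (Y₁ + (E + (Y₂ + Y₃))))
      ≡⟨ eq₁ h r ℓ k′ Y₁ E Y₂ Y₃ ⟩
    4 * P * (2 * (r * h) * E) + h * r * (8 * P * Y₁ + 8 * P * Y₂ + 8 * P * Y₃)
      ≤⟨ +-mono-≤ (*-monoʳ-≤ (4 * P) E≤) (*-monoʳ-≤ (h * r) (+-mono-≤ (+-mono-≤ Y₁≤ Y₂≤) Y₃≤)) ⟩
    4 * P * ((r′ * h + 1) * (n * suc n) + r * h * (t * t)) + h * r * (n * n + n * n + n * n)
      ≡⟨ eq₂ P r′ h n₀ t r ⟩
    4 * P * (r′ * h * (n * n₀)) + (4 * P * (n * n) + 4 * P * (2 * r′ * h * n + n) + r * h * (4 * P * (t * t)))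
      + h * r * (n * n + n * n + n * n)
      ≤⟨ +-monoˡ-≤ (h * r * (n * n + n * n + n * n)) (+-monoʳ-≤ (4 * P * (r′ * h * (n * n₀)))
           (+-mono-≤ (+-mono-≤ quadratic linear) (*-monoʳ-≤ (r * h) small))) ⟩
    4 * P * (r′ * h * (n * n₀)) + (h * r * (n * n) + h * r * (n * n) + r * h * (n * n))
      + h * r * (n * n + n * n + n * n)
      ≤⟨ m≤m+n _ (2 * (h * r * (n * n))) ⟩
    4 * P * (r′ * h * (n * n₀)) + (h * r * (n * n) + h * r * (n * n) + r * h * (n * n))
      + h * r * (n * n + n * n + n * n) + 2 * (h * r * (n * n))
      ≡⟨ eq₃ ℓ k′ r′ h (n * n₀) r (n * n) ⟩
    4 * h * (r′ * (n * n₀) * ℓ * k′ + 2 * r * (n * n)) ∎)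
  where
  open ≤-Reasoning
  r = suc r′
  ℓ = suc r
  h = 8 * k′
  n = suc n₀
  eq₁ : ∀ h r ℓ k Y₁ E Y₂ Y₃ → 4 * h * (2 * r * ℓ * k * (Y₁ + (E + (Y₂ + Y₃)))) ≡
    4 * (ℓ * k) * (2 * (r * h) * E) + h * r * (8 * (ℓ * k) * Y₁ + 8 * (ℓ * k) * Y₂ + 8 * (ℓ * k) * Y₃)
  eq₁ = solve-∀
  eq₂ : ∀ P r′ h n₀ t r →
    4 * P * ((r′ * h + 1) * (suc n₀ * suc (suc n₀)) + r * h * (t * t)) + h * r * (suc n₀ * suc n₀ + suc n₀ * suc n₀ + suc n₀ * suc n₀) ≡
    4 * P * (r′ * h * (suc n₀ * n₀)) + (4 * P * (suc n₀ * suc n₀) + 4 * P * (2 * r′ * h * suc n₀ + suc n₀) + r * h * (4 * P * (t * t)))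
      + h * r * (suc n₀ * suc n₀ + suc n₀ * suc n₀ + suc n₀ * suc n₀)
  eq₂ = solve-∀
  eq₃ : ∀ ℓ k r′ h a r b →
    4 * (ℓ * k) * (r′ * h * a) + (h * r * b + h * r * b + r * h * b) + h * r * (b + b + b) + 2 * (h * r * b) ≡
    4 * h * (r′ * a * ℓ * k + 2 * r * b)
  eq₃ = solve-∀
  quadratic : 4 * P * (n * n) ≤ h * r * (n * n)
  -- This term is the slack 1/(r h) in the density. It needs 4 ℓ k′ ≤ 8 k′ r, which holds as ℓ ≤ 2
  -- r; hence the 8 in `h`.
  quadratic = *-monoˡ-≤ (n * n) (≤-trans (m≤m+n (4 * P) (4 * (r′ * k′))) (≤-reflexive (eq r′ k′)))
    where
    eq : ∀ r′ k → 4 * (suc (suc r′) * k) + 4 * (r′ * k) ≡ 8 * k * suc r′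
    eq = solve-∀
  linear : 4 * P * (2 * r′ * h * n + n) ≤ h * r * (n * n)
  linear = begin
    4 * P * (2 * r′ * h * n + n)             ≤⟨ *-monoʳ-≤ (4 * P) (+-monoʳ-≤ (2 * r′ * h * n) (m≤n*m n (2 * h) {{m*n≢0 2 h {{it}} {{m*n≢0 8 k′}}}})) ⟩
    4 * P * (2 * r′ * h * n + 2 * h * n)     ≡⟨ eq P r′ h n ⟩
    8 * P * (h * r * n)                      ≤⟨ *-monoˡ-≤ (h * r * n) n≥ ⟩
    n * (h * r * n)                          ≡⟨ eq′ n (h * r) ⟩
    h * r * (n * n)                          ∎
    where
    eq : ∀ P r′ h n → 4 * P * (2 * r′ * h * n + 2 * h * n) ≡ 8 * P * (h * suc r′ * n)
    eq = solve-∀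
    eq′ : ∀ n a → n * (a * n) ≡ a * (n * n)
    eq′ = solve-∀
  small : 4 * P * (t * t) ≤ n * n
  small = begin
    4 * P * (t * t)              ≤⟨ *-monoˡ-≤ (t * t) (*-monoʳ-≤ 4 (m≤m*n P P {{m*n≢0 ℓ k′}})) ⟩
    4 * (P * P) * (t * t)        ≡⟨ eq P t ⟩
    2 * P * t * (2 * P * t)      ≤⟨ *-mono-≤ t≤ t≤ ⟩
    n * n                        ∎
    where
    eq : ∀ P t → 4 * (P * P) * (t * t) ≡ 2 * P * t * (2 * P * t)
    eq = solve-∀

-- Both ℓ and k are replaced by powers of two, so that they separate in the exponent: the part with
-- k becomes the constant `c` of `power-bound`, which does not depend on ℓ.
8P[1+16P]-bound : ∀ ℓ k → let P = ℓ * k in 8 * P * suc (16 * P) ≤ 2 ^ (8 + 2 * k + 2 * ℓ)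
8P[1+16P]-bound ℓ k = begin
  8 * P * suc (16 * P)              ≤⟨ *-mono-≤ (*-monoʳ-≤ 8 P≤Z) (s≤s (*-monoʳ-≤ 16 P≤Z)) ⟩
  8 * Z * (1 + 16 * Z)              ≤⟨ *-monoʳ-≤ (8 * Z) (+-monoˡ-≤ (16 * Z) (≤-trans (m^n>0 2 s) (m≤n*m Z 16))) ⟩
  8 * Z * (16 * Z + 16 * Z)         ≡⟨ cong (8 * Z *_) (eq Z) ⟩
  8 * Z * (32 * Z)                  ≡⟨ cong₂ _*_ (^-distribˡ-+-* 2 3 s) (^-distribˡ-+-* 2 5 s) ⟨
  2 ^ (3 + s) * 2 ^ (5 + s)         ≡⟨ ^-distribˡ-+-* 2 (3 + s) (5 + s) ⟨
  2 ^ (3 + s + (5 + s))             ≡⟨ cong (2 ^_) (eq′ ℓ k) ⟩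
  2 ^ (8 + 2 * k + 2 * ℓ)           ∎
  where
  open ≤-Reasoning
  P = ℓ * k
  s = ℓ + k
  Z = 2 ^ s
  P≤Z : P ≤ Z
  P≤Z = ≤-trans (*-mono-≤ (n≤2^n ℓ) (n≤2^n k)) (≤-reflexive (sym (^-distribˡ-+-* 2 ℓ k)))
  eq : ∀ z → 16 * z + 16 * z ≡ 32 * z
  eq = solve-∀
  eq′ : ∀ ℓ k → 3 + (ℓ + k) + (5 + (ℓ + k)) ≡ 8 + 2 * k + 2 * ℓ
  eq′ = solve-∀

-- Squaring allows the two lower bounds on `n` to be multiplied. The doubled exponent is 16 ℓ³ + 8 c
-- ℓ², where 16 ℓ³ ≤ 6 ℓ⁴ because ℓ ≥ 3, and 8 c ℓ² ≤ (8 c)² + ℓ⁴.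
power-bound : ∀ ℓ c H n → 3 ≤ ℓ → H ≤ 2 ^ (c + 2 * ℓ) → 2 ^ (8 * ℓ ^ 4) ≤ n → 2 ^ (8 * c * (8 * c)) ≤ n →
  H ^ (4 * (ℓ * ℓ)) ≤ n
power-bound ℓ c H n 3≤ℓ H≤ n≥₁ n≥₂ = square-cancel-≤ (begin
  H ^ e * H ^ e                                        ≤⟨ *-mono-≤ H^e≤ H^e≤ ⟩
  2 ^ (b * e) * 2 ^ (b * e)                            ≡⟨ ^-distribˡ-+-* 2 (b * e) (b * e) ⟨
  2 ^ (b * e + b * e)                                  ≤⟨ ^-monoʳ-≤ 2 exponent ⟩
  2 ^ (8 * ℓ ^ 4 + 8 * c * (8 * c))                    ≡⟨ ^-distribˡ-+-* 2 (8 * ℓ ^ 4) (8 * c * (8 * c)) ⟩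
  2 ^ (8 * ℓ ^ 4) * 2 ^ (8 * c * (8 * c))              ≤⟨ *-mono-≤ n≥₁ n≥₂ ⟩
  n * n                                                ∎)
  where
  open ≤-Reasoning
  e b : ℕ
  e = 4 * (ℓ * ℓ)
  b = c + 2 * ℓ
  H^e≤ : H ^ e ≤ 2 ^ (b * e)
  H^e≤ = ≤-trans (^-monoˡ-≤ e H≤) (≤-reflexive (^-*-assoc 2 b e))
  product≤squares : ∀ x y → x * y ≤ x * x + y * y
  product≤squares x y with ≤-total x y
  ... | inj₁ x≤y = ≤-trans (*-monoˡ-≤ y x≤y) (m≤n+m (y * y) (x * x))
  ... | inj₂ y≤x = ≤-trans (*-monoʳ-≤ x y≤x) (m≤m+n (x * x) (y * y))
  eq₁ : ∀ ℓ c → (c + 2 * ℓ) * (4 * (ℓ * ℓ)) + (c + 2 * ℓ) * (4 * (ℓ * ℓ)) ≡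
    16 * (ℓ * ℓ * ℓ) + 8 * c * (ℓ * ℓ)
  eq₁ = solve-∀
  eq₂ : ∀ ℓ c → 6 * ℓ * (ℓ * ℓ * ℓ) + (c * c + ℓ * ℓ * (ℓ * ℓ)) + ℓ * ℓ * (ℓ * ℓ) ≡
    8 * (ℓ * (ℓ * (ℓ * (ℓ * 1)))) + c * c
  eq₂ = solve-∀
  exponent : b * e + b * e ≤ 8 * ℓ ^ 4 + 8 * c * (8 * c)
  exponent = begin
    b * e + b * e                                ≡⟨ eq₁ ℓ c ⟩
    16 * (ℓ * ℓ * ℓ) + 8 * c * (ℓ * ℓ)
      ≤⟨ +-mono-≤ (*-monoˡ-≤ (ℓ * ℓ * ℓ) (≤-trans (m≤m+n 16 2) (*-monoʳ-≤ 6 3≤ℓ))) (product≤squares (8 * c) (ℓ * ℓ)) ⟩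
    6 * ℓ * (ℓ * ℓ * ℓ) + (8 * c * (8 * c) + ℓ * ℓ * (ℓ * ℓ))
      ≤⟨ m≤m+n _ (ℓ * ℓ * (ℓ * ℓ)) ⟩
    6 * ℓ * (ℓ * ℓ * ℓ) + (8 * c * (8 * c) + ℓ * ℓ * (ℓ * ℓ)) + ℓ * ℓ * (ℓ * ℓ)
      ≡⟨ eq₂ ℓ (8 * c) ⟩
    8 * ℓ ^ 4 + 8 * c * (8 * c) ∎

-- The permitted error is n²/P. Each of the at most n²/H edges outside a container costs 1 + q bits,
-- so H = 8 P (1 + q) keeps this share at n²/(8 P). The value q = 16 P gives 2^q ≥ 16 P, as
-- `w-large` demands, without introducing logarithms.
module Upper (r′ k n₀ P H : ℕ) .{{_ : NonZero P}} .{{_ : NonZero H}}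
  (P-def : P ≡ suc (suc r′) * suc k) (H-def : H ≡ 8 * P * suc (16 * P)) where

  r ℓ k′ n q : ℕ
  r  = suc r′
  ℓ  = suc r
  k′ = suc k
  n  = suc n₀
  q  = 16 * P

  module _ (r′>0 : 1 ≤ r′) (n-large : H ^ (4 * (ℓ * ℓ)) ≤ n) where

    open ≤-Reasoning

    private instance
      8P≢0 : NonZero (8 * P)
      8P≢0 = m*n≢0 8 P
      2P≢0 : NonZero (2 * P)
      2P≢0 = m*n≢0 2 P

    e θ t w h′ κ : ℕ
    e  = ℓ * ℓ + ℓ
    -- Of these factors `H`, ℓ² pay for the exchanges, ℓ for (8 k′ · 2 P)^ℓ, and the last one for
    -- the number of pairs `κ`.
    θ  = H ^ suc e
    t  = n / (2 * P)
    w  = n * n / (8 * P)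
    -- Chosen so that `suc h′` is `8 * k′` by computation.
    h′ = k + 7 * suc k
    κ  = length (pairs ℓ)

    private instance
      θ≢0 : NonZero θ
      θ≢0 = m^n≢0 H (suc e)

    k′≤P : k′ ≤ P
    k′≤P = ≤-trans (m≤n*m k′ ℓ) (≤-reflexive (sym P-def))

    ℓ≤P : ℓ ≤ P
    ℓ≤P = ≤-trans (m≤m*n ℓ k′) (≤-reflexive (sym P-def))

    P>0 : 1 ≤ P
    P>0 = >-nonZero⁻¹ P

    24P≤H : 24 * P ≤ H
    24P≤H = begin
      24 * P               ≡⟨ eq P ⟩
      8 * P * 3            ≤⟨ *-monoʳ-≤ (8 * P) (s≤s (≤-trans (m≤m+n 2 14) (*-monoʳ-≤ 16 P>0))) ⟩
      8 * P * suc (16 * P) ≡⟨ H-def ⟨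
      H                    ∎
      where
      eq : ∀ p → 24 * p ≡ 8 * p * 3
      eq = solve-∀

    8P≤n : 8 * P ≤ n
    8P≤n = begin
      8 * P                ≤⟨ *-monoˡ-≤ P (m≤m+n 8 16) ⟩
      24 * P               ≤⟨ 24P≤H ⟩
      H                    ≡⟨ *-identityʳ H ⟨
      H ^ 1                ≤⟨ ^-monoʳ-≤ H {1} {4 * (ℓ * ℓ)} (s≤s z≤n) ⟩
      H ^ (4 * (ℓ * ℓ))    ≤⟨ n-large ⟩
      n                    ∎

    w-large : n * n ≤ 2 ^ q * w
    w-large = begin
      n * n                ≤⟨ <⇒≤ (n<d*suc[n/d] (n * n) (8 * P)) ⟩
      8 * P * (1 + w)      ≤⟨ *-monoʳ-≤ (8 * P) (+-monoˡ-≤ w w>0) ⟩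
      8 * P * (w + w)      ≡⟨ eq P w ⟩
      16 * P * w           ≤⟨ *-monoˡ-≤ w (n≤2^n q) ⟩
      2 ^ q * w            ∎
      where
      w>0 : 0 < w
      w>0 = m≥n⇒m/n>0 (≤-trans 8P≤n (m≤m*n n n))
      eq : ∀ p w → 8 * p * (w + w) ≡ 16 * p * w
      eq = solve-∀

    hp≤H : 8 * k′ * (2 * P) ≤ H
    hp≤H = begin
      8 * k′ * (2 * P)       ≤⟨ *-monoˡ-≤ (2 * P) (*-monoʳ-≤ 8 k′≤P) ⟩
      8 * P * (2 * P)        ≤⟨ *-monoʳ-≤ (8 * P) (≤-trans (*-monoˡ-≤ P (m≤m+n 2 14)) (n≤1+n q)) ⟩
      8 * P * suc (16 * P)   ≡⟨ H-def ⟨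
      H                      ∎

    κ<H : κ < H
    κ<H = begin-strict
      κ                      ≤⟨ length-pairs ℓ ⟩
      ℓ * ℓ                  ≤⟨ *-mono-≤ ℓ≤P ℓ≤P ⟩
      P * P                  ≤⟨ *-mono-≤ (m≤n*m P 8) (m≤n*m P 16) ⟩
      8 * P * (16 * P)       <⟨ *-monoʳ-< (8 * P) (n<1+n (16 * P)) ⟩
      8 * P * suc (16 * P)   ≡⟨ H-def ⟨
      H                      ∎

    θ-large : suc h′ ^ ℓ * (κ * H ^ κ * n ^ ℓ) < θ * suc t ^ ℓ
    θ-large = begin-strict
      (8 * k′) ^ ℓ * (κ * H ^ κ * n ^ ℓ)
        ≤⟨ *-monoʳ-≤ ((8 * k′) ^ ℓ) (*-mono-≤ (*-monoʳ-≤ κ (^-monoʳ-≤ H (length-pairs ℓ))) n^ℓ≤) ⟩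
      (8 * k′) ^ ℓ * (κ * H ^ (ℓ * ℓ) * ((2 * P) ^ ℓ * suc t ^ ℓ))
        ≡⟨ eq ((8 * k′) ^ ℓ) κ (H ^ (ℓ * ℓ)) ((2 * P) ^ ℓ) (suc t ^ ℓ) ⟩
      κ * (H ^ (ℓ * ℓ) * ((8 * k′) ^ ℓ * (2 * P) ^ ℓ) * suc t ^ ℓ)
        ≡⟨ cong (λ z → κ * (H ^ (ℓ * ℓ) * z * suc t ^ ℓ)) (^-distribʳ-* ℓ (8 * k′) (2 * P)) ⟨
      κ * (H ^ (ℓ * ℓ) * (8 * k′ * (2 * P)) ^ ℓ * suc t ^ ℓ)
        ≤⟨ *-monoʳ-≤ κ (*-monoˡ-≤ (suc t ^ ℓ) (*-monoʳ-≤ (H ^ (ℓ * ℓ)) (^-monoˡ-≤ ℓ hp≤H))) ⟩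
      κ * (H ^ (ℓ * ℓ) * H ^ ℓ * suc t ^ ℓ)
        ≡⟨ cong (λ z → κ * (z * suc t ^ ℓ)) (^-distribˡ-+-* H (ℓ * ℓ) ℓ) ⟨
      κ * (H ^ e * suc t ^ ℓ)
        <⟨ *-monoˡ-< (H ^ e * suc t ^ ℓ) {{m*n≢0 (H ^ e) (suc t ^ ℓ) {{m^n≢0 H e}} {{m^n≢0 (suc t) ℓ}}}} κ<H ⟩
      H * (H ^ e * suc t ^ ℓ)
        ≡⟨ *-assoc H (H ^ e) (suc t ^ ℓ) ⟨
      θ * suc t ^ ℓ ∎
      where
      eq : ∀ a b c d f → a * (b * c * (d * f)) ≡ b * (c * (a * d) * f)
      eq = solve-∀
      n^ℓ≤ : n ^ ℓ ≤ (2 * P) ^ ℓ * suc t ^ ℓ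
      n^ℓ≤ = ≤-trans (^-monoˡ-≤ ℓ (<⇒≤ (n<d*suc[n/d] n (2 * P)))) (≤-reflexive (^-distribʳ-* ℓ (2 * P) (suc t)))

    open Container n r h′ θ H t q w θ-large w-large
      using (M; E; m; 2rh; 2rh≢0; numCliqueFree-≤)

    -- With M = H^(ℓ²+ℓ+2) the left side is at most H^(2ℓ²+2ℓ+5), and 2 ℓ² + 2 ℓ + 5 ≤ 4 ℓ² from ℓ =
    -- 3 on. This is the origin of the exponent in `n-large`.
    24PM²≤n : 24 * P * (M * M) ≤ n
    24PM²≤n = begin
      24 * P * (M * M)                   ≤⟨ *-monoˡ-≤ (M * M) 24P≤H ⟩
      H * (θ * H * (θ * H))              ≡⟨ cong (λ z → H * (z * z)) (*-comm θ H) ⟩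
      H * (H ^ (2 + e) * H ^ (2 + e))    ≡⟨ cong (H *_) (^-distribˡ-+-* H (2 + e) (2 + e)) ⟨
      H ^ suc (2 + e + (2 + e))          ≤⟨ ^-monoʳ-≤ H exponent ⟩
      H ^ (4 * (ℓ * ℓ))                  ≤⟨ n-large ⟩
      n                                  ∎
      where
      eq : ∀ r → suc (2 + ((2 + r) * (2 + r) + (2 + r)) + (2 + ((2 + r) * (2 + r) + (2 + r)))) + (6 * r + 2 * (r * r)) ≡
        4 * ((2 + r) * (2 + r)) + 1
      eq = solve-∀
      exponent : suc (2 + e + (2 + e)) ≤ 4 * (ℓ * ℓ)
      exponent = +-cancelʳ-≤ 1 _ _ (≤-trans
        (+-monoʳ-≤ (suc (2 + e + (2 + e))) (≤-trans r′>0 (≤-trans (m≤n*m r′ 6) (m≤m+n (6 * r′) (2 * (r′ * r′))))))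
        (≤-reflexive (eq r′)))

    codes-small : 8 * P * (suc (n + n) * (M * M)) ≤ n * n
    codes-small = begin
      8 * P * (suc (n + n) * (M * M))    ≤⟨ *-monoʳ-≤ (8 * P) (*-monoˡ-≤ (M * M) (+-monoˡ-≤ (n + n) (s≤s (z≤n {n₀})))) ⟩
      8 * P * ((n + (n + n)) * (M * M))  ≡⟨ eq P n (M * M) ⟩
      24 * P * (M * M) * n               ≤⟨ *-monoˡ-≤ n 24PM²≤n ⟩
      n * n                              ∎
      where
      eq : ∀ p n m → 8 * p * ((n + (n + n)) * m) ≡ 24 * p * m * n
      eq = solve-∀

    E-bound : 2 * (r * (8 * k′)) * E ≤ (r′ * (8 * k′) + 1) * (n * suc n) + r * (8 * k′) * (t * t)
    E-bound = ≤-trans (d*[n/d]≤n _ 2rh) (≤-reflexive (cong (λ z → z * (n * suc n) + r * (8 * k′) * (t * t)) eq))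
      where
      eq : r * suc h′ ∸ h′ ≡ r′ * (8 * k′) + 1
      eq = trans (cong (_∸ h′) (sym (+-suc h′ (r′ * suc h′))))
        (trans (m+n∸m≡n h′ (suc (r′ * suc h′))) (+-comm 1 (r′ * suc h′)))

    upper-bound : numCliqueFree n ℓ ^ (2 * r * ℓ * k′) ≤ 2 ^ (r′ * (n * n₀) * ℓ * k′ + 2 * r * (n * n))
    upper-bound = begin
      numCliqueFree n ℓ ^ Q              ≤⟨ ^-monoˡ-≤ Q numCliqueFree-≤ ⟩
      (2 ^ X) ^ Q                        ≡⟨ ^-*-assoc 2 X Q ⟩
      2 ^ (X * Q)                        ≡⟨ cong (2 ^_) (*-comm X Q) ⟩
      2 ^ (Q * X)                        ≤⟨ ^-monoʳ-≤ 2 (exponent-bound r′ k′ n₀ P E t _ _ _ P-def E-bound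
                                              (d*[n/d]≤n n (2 * P)) 8P≤n codes-small outside-small (d*[n/d]≤n (n * n) (8 * P))) ⟩
      2 ^ (r′ * (n * n₀) * ℓ * k′ + 2 * r * (n * n)) ∎
      where
      Q X : ℕ
      Q = 2 * r * ℓ * k′
      X = suc (n + n) * (M * M) + (E + (suc q * m + w))
      outside-small : 8 * P * (suc q * m) ≤ n * n
      outside-small = ≤-trans (≤-reflexive (trans (sym (*-assoc (8 * P) (suc q) m)) (cong (_* m) (sym H-def)))) (d*[n/d]≤n (n * n) H)

-- The two bounds and their combination.

lower-bound : ∀ r′ k′ n → let r = suc r′ ; ℓ = suc r in
  2 ^ (r′ * (n * (n ∸ 1)) * ℓ * k′) ≤ numCliqueFree n ℓ ^ (2 * r * ℓ * k′)
lower-bound r′ k′ n = begin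
  2 ^ (r′ * (n * (n ∸ 1)) * ℓ * k′)
    ≤⟨ ^-monoʳ-≤ 2 (*-monoˡ-≤ k′ (*-monoˡ-≤ ℓ (turán-edges r′ n))) ⟩
  2 ^ (2 * (r * o) * ℓ * k′)                 ≡⟨ cong (2 ^_) (eq r o ℓ k′) ⟩
  2 ^ (o * (2 * r * ℓ * k′))                 ≡⟨ ^-*-assoc 2 o (2 * r * ℓ * k′) ⟨
  (2 ^ o) ^ (2 * r * ℓ * k′)                 ≤⟨ ^-monoˡ-≤ (2 * r * ℓ * k′) (numCliqueFree-≥ r n) ⟩
  numCliqueFree n ℓ ^ (2 * r * ℓ * k′)       ∎
  where
  open ≤-Reasoning
  r = suc r′
  ℓ = suc r
  o = ones (turánMask r n)
  eq : ∀ r o ℓ k → 2 * (r * o) * ℓ * k ≡ o * (2 * r * ℓ * k)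
  eq = solve-∀

-- With f the number of K_ℓ-free graphs, this is |log₂ f - (1 - 1/(ℓ-1)) n(n-1)/2| ≤ n²/(ℓ k′),
-- multiplied by 2 (ℓ-1) ℓ k′ and exponentiated to base 2, so that only naturals occur. Letting k′
-- run over all positive integers expresses the o(n²/ℓ).
CountBounds : ℕ → ℕ → ℕ → Set
CountBounds ℓ n k′ =
  (2 ^ ((ℓ ∸ 2) * (n * (n ∸ 1)) * ℓ * k′)
     ≤ numCliqueFree n ℓ ^ (2 * (ℓ ∸ 1) * ℓ * k′) * 2 ^ (2 * (ℓ ∸ 1) * (n * n)))
  × (numCliqueFree n ℓ ^ (2 * (ℓ ∸ 1) * ℓ * k′)
     ≤ 2 ^ ((ℓ ∸ 2) * (n * (n ∸ 1)) * ℓ * k′ + 2 * (ℓ ∸ 1) * (n * n)))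

countBounds : ∀ ℓ k n P H → 3 ≤ ℓ → P ≡ ℓ * suc k → H ≡ 8 * P * suc (16 * P) →
  H ^ (4 * (ℓ * ℓ)) ≤ n → 1 ≤ n → CountBounds ℓ n (suc k)
countBounds (suc (suc r′)) k n@(suc n₀) P H (s≤s (s≤s r′>0)) P-def H-def n-large _ =
  ≤-trans (lower-bound r′ (suc k) n) (m≤m*n _ _ {{m^n≢0 2 (2 * suc r′ * (n * n))}}) ,
  Upper.upper-bound r′ k n₀ P H P-def H-def r′>0 n-large
  where
  instance
    P≢0 : NonZero P
    P≢0 = subst NonZero (sym P-def) (m*n≢0 (suc (suc r′)) (suc k))
    H≢0 : NonZero H
    H≢0 = subst NonZero (sym H-def) (m*n≢0 (8 * P) (suc (16 * P)) {{m*n≢0 8 P}})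

theorem1 : (ℓ : ℕ → ℕ) →
    Σ ℕ (λ n₀ → (n : ℕ) → n ≥ n₀ → (3 ≤ ℓ n) × ExpLe (16 * ℓ n ^ 4) n) →
    (k : ℕ) → Σ ℕ (λ N → (n : ℕ) → n ≥ N →
    (2 ^ ((ℓ n ∸ 2) * (n * (n ∸ 1)) * ℓ n * (k + 1))
    ≤ numCliqueFree n (ℓ n) ^ (2 * (ℓ n ∸ 1) * ℓ n * (k + 1)) * 2 ^ (2 * (ℓ n ∸ 1) * (n * n)))
    × (numCliqueFree n (ℓ n) ^ (2 * (ℓ n ∸ 1) * ℓ n * (k + 1))
    ≤ 2 ^ ((ℓ n ∸ 2) * (n * (n ∸ 1)) * ℓ n * (k + 1) + 2 * (ℓ n ∸ 1) * (n * n))))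
theorem1 ℓ (n₀ , hyp) k = main (8 + 2 * suc k) refl
  where
  main : ∀ c → c ≡ 8 + 2 * suc k → Σ ℕ λ N → ∀ n → n ≥ N → CountBounds (ℓ n) n (k + 1)
  -- `n₀` brings the hypotheses on ℓ into force; the power of two absorbs the part of `H` that
  -- depends on `k`, as `power-bound` requires.
  main c c-def = n₀ + 2 ^ (8 * c * (8 * c)) , λ n n≥ →
    let n≥₀ = ≤-trans (m≤m+n n₀ _) n≥
        n≥₁ = ≤-trans (m≤n+m _ n₀) n≥
        3≤ℓ , e^16ℓ⁴≤n = hyp n n≥₀
        P = ℓ n * suc k
        -- The hypothesis ℓ ≤ (log n)^(1/4)/2 amounts to log n ≥ 16 ℓ⁴ = 2 · 8 ℓ⁴, which yields 2^(8
        -- ℓ⁴) ≤ n.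
        n≥₂ = ExpLe⇒2^m≤n (8 * ℓ n ^ 4) n (subst (λ z → ExpLe z n) (*-assoc 2 8 (ℓ n ^ 4)) e^16ℓ⁴≤n)
        H≤ = subst (λ z → 8 * P * suc (16 * P) ≤ 2 ^ (z + 2 * ℓ n)) (sym c-def) (8P[1+16P]-bound (ℓ n) (suc k))
    in subst (CountBounds (ℓ n) n) (+-comm 1 k)
         (countBounds (ℓ n) k n P (8 * P * suc (16 * P)) 3≤ℓ refl refl
           (power-bound (ℓ n) c _ n 3≤ℓ H≤ n≥₂ n≥₁) (≤-trans (m^n>0 2 (8 * c * (8 * c))) n≥₁))
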